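{- Let $r\ge 1$ and $0\le d\le 2r-2$ be integers. Every $d$-dimensional face of the Kostka polytope $P_r$ has at most $\prod_{i=1}^3\left\lfloor\frac{d+2+i}{3}\right\rfloor$ vertices.
   Context: For a positive integer $r$, a partition with at most $r$ parts is written as a non-increasing $r$-tuple of nonnegative integers; $\mathrm{Par}_r(n)$ is the set of such tuples with entries summing to $n$. For $\lambda,\mu\in\mathrm{Par}_r(n)$, $\lambda$ dominates $\mu$ if $\sum_{i=1}^k\lambda_i\ge\sum_{i=1}^k\mu_i$ for all $k\le r$. The $r$-Kostka cone $\mathcal{K}_r\subseteq\mathbb{R}^{2r}$ is the convex hull of all points $(\lambda_1,\dots,\lambda_r,\mu_1,\dots,\mu_r)$ with $\lambda,\mu\in\mathrm{Par}_r(n)$ for some $n$ and $\lambda$ dominating $\mu$. The Kostka polytope $P_r$ is the $(2r-2)$-dimensional polytope $\mathcal{K}_r\cap\{x:\sum_{i=1}^r(\lambda_i+\mu_i)=1\}$.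
   Formalization: The Kostka cone and polytope, their faces (supporting functionals), dimensions and vertices are taken over the rational numbers instead of the reals; since the polytope is rational, its faces and vertices are the same. -}

module Defs where

open import Data.Nat as ℕ using (ℕ; zero; suc)
open import Data.Fin as Fin using (Fin; zero; suc)
open import Data.Integer using (+_)
open import Data.Rational as ℚ using (ℚ; 0ℚ; 1ℚ; _/_)
open import Data.Product using (Σ; ∃; ∃-syntax; _×_; _,_)
open import Relation.Binary.PropositionalEquality using (_≡_)
open import Relation.Nullary using (¬_)

sumℕ : ∀ {k} → (Fin k → ℕ) → ℕ
sumℕ {zero}  f = 0
sumℕ {suc k} f = f zero ℕ.+ sumℕ (λ i → f (suc i))

sumℚ : ∀ {k} → (Fin k → ℚ) → ℚ
sumℚ {zero}  f = 0ℚ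
sumℚ {suc k} f = f zero ℚ.+ sumℚ (λ i → f (suc i))

-- prefixSum f k = f 0 + ... + f (k-1)  (all terms if k ≥ r)
prefixSum : ∀ {r} → (Fin r → ℕ) → ℕ → ℕ
prefixSum {zero}  f k       = 0
prefixSum {suc r} f zero    = 0
prefixSum {suc r} f (suc k) = f zero ℕ.+ prefixSum (λ i → f (suc i)) k

-- λ is a partition with at most r parts (non-increasing r-tuple of naturals)
IsPartition : ∀ {r} → (Fin r → ℕ) → Set
IsPartition {r} l = ∀ (i j : Fin r) → i Fin.≤ j → l j ℕ.≤ l i

Dominates : ∀ {r} → (Fin r → ℕ) → (Fin r → ℕ) → Set
Dominates {r} l m = ∀ (k : ℕ) → k ℕ.≤ r → prefixSum m k ℕ.≤ prefixSum l k

-- Points of ℚ^{2r}, written as pairs (λ-coordinates, μ-coordinates)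

Pt : ℕ → Set
Pt r = (Fin r → ℚ) × (Fin r → ℚ)

_≈P_ : ∀ {r} → Pt r → Pt r → Set
_≈P_ {r} (x₁ , x₂) (y₁ , y₂) = (∀ i → x₁ i ≡ y₁ i) × (∀ i → x₂ i ≡ y₂ i)

toℚ : ℕ → ℚ
toℚ n = + n / 1

embed : ∀ {r} → (Fin r → ℕ) → (Fin r → ℕ) → Pt r
embed l m = (λ i → toℚ (l i)) , (λ i → toℚ (m i))

KostkaGen : ∀ r → Pt r → Set
KostkaGen r x =
  ∃[ l ] ∃[ m ] (IsPartition {r} l × IsPartition m × sumℕ l ≡ sumℕ m
                 × Dominates l m × x ≈P embed l m)

combo : ∀ {r k} → (Fin k → ℚ) → (Fin k → Pt r) → Pt r
combo c p = (λ i → sumℚ (λ j → c j ℚ.* Data.Product.proj₁ (p j) i))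
          , (λ i → sumℚ (λ j → c j ℚ.* Data.Product.proj₂ (p j) i))

-- (rational points of) the convex hull of a set S
ConvHull : ∀ {r} → (Pt r → Set) → Pt r → Set
ConvHull {r} S x =
  ∃[ k ] Σ (Fin k → ℚ) λ c → Σ (Fin k → Pt r) λ p →
    (∀ j → S (p j)) × (∀ j → 0ℚ ℚ.≤ c j) × sumℚ c ≡ 1ℚ × x ≈P combo c p

KostkaCone : ∀ r → Pt r → Set
KostkaCone r = ConvHull (KostkaGen r)

coordSum : ∀ {r} → Pt r → ℚ
coordSum (x₁ , x₂) = sumℚ x₁ ℚ.+ sumℚ x₂

KostkaPolytope : ∀ r → Pt r → Set
KostkaPolytope r x = KostkaCone r x × coordSum x ≡ 1ℚ

dot : ∀ {r} → Pt r → Pt r → ℚ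
dot (a₁ , a₂) (x₁ , x₂) = sumℚ (λ i → a₁ i ℚ.* x₁ i) ℚ.+ sumℚ (λ i → a₂ i ℚ.* x₂ i)

ValidIneq : ∀ {r} → (Pt r → Set) → Pt r → ℚ → Set
ValidIneq P a b = ∀ x → P x → dot a x ℚ.≤ b

-- the face of P cut out by a valid inequality a·x ≤ b
-- (a = 0, b = 0 gives P itself)
FaceOf : ∀ {r} → (Pt r → Set) → Pt r → ℚ → Pt r → Set
FaceOf P a b x = P x × dot a x ≡ b

AffinelyIndependent : ∀ {r k} → (Fin k → Pt r) → Set
AffinelyIndependent {r} {k} p =
  ∀ (c : Fin k → ℚ) → sumℚ c ≡ 0ℚ →
    combo c p ≈P ((λ _ → 0ℚ) , (λ _ → 0ℚ)) → ∀ j → c j ≡ 0ℚ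

HasDimension : ∀ {r} → (Pt r → Set) → ℕ → Set
HasDimension {r} F d =
  (Σ (Fin (suc d) → Pt r) λ p → (∀ j → F (p j)) × AffinelyIndependent p)
  × (∀ (p : Fin (suc (suc d)) → Pt r) → (∀ j → F (p j)) → ¬ AffinelyIndependent p)

IsVertex : ∀ {r} → (Pt r → Set) → Pt r → Set
IsVertex {r} F x =
  F x × (∀ (y z : Pt r) (t : ℚ) → F y → F z → 0ℚ ℚ.< t → t ℚ.< 1ℚ →
           x ≈P combo {k = 2} (λ { zero → t ; (suc _) → 1ℚ ℚ.- t })
                              (λ { zero → y ; (suc _) → z })
           → y ≈P z)

Distinct : ∀ {r k} → (Fin k → Pt r) → Set
Distinct p = ∀ i j → p i ≈P p j → i ≡ j

{-# OPTIONS --safe #-}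
module Submission where

-- With ω_j = (1^j, 0^(r-j)), the extremal rays of the Kostka cone are spanned by the pairs
-- (ω_j , ω_j) and ((k - i) ω_j , (k - j) ω_i + (j - i) ω_k) for 0 ≤ i < j < k ≤ r.  The vertices of a
-- face are therefore normalised rays on which the supporting functional vanishes ("tight" rays).
-- Let H j and Q j be the values of the functional, made nonnegative on the cone, at (ω_j , 0) and
-- (0 , ω_j).  Then -H lies below every chord of the graph of Q, and the ray of i < j < k is tight
-- when the chord over [i , k] passes through (j , -H j).  All tight chords over j lie on one line
-- that supports the graph of Q from below.
-- Let n be the number of j that occur, and m the number of points at which one of these lines
-- touches the graph strictly between its first and last touching points.  The widest chord over each j
-- and one ray ending at each inner touching point are n + m linearly independent points of the
-- face, so n + m ≤ d + 1.  For each j there are at most x z tight rays for some x + z ≤ m + 2, hence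
-- there are at most n x z vertices for some n + x + z ≤ d + 3.

open import Defs
open import Data.Nat using (ℕ; zero; suc; _≤_; _<_; _*_; _+_; _∸_; _/_; _%_; z≤n; s≤s; _≟_; _≤?_; _<?_)
open import Data.Nat.Properties
open import Data.Nat.DivMod using (m≡m%n+[m/n]*n; m%n<n; m*n/n≡m; +-distrib-/-∣ʳ)
open import Data.Nat.Divisibility using (n∣m*n)
open import Data.Nat.Solver using () renaming (module +-*-Solver to ℕS)
open import Data.Integer as ℤ using (-[1+_])
import Data.Integer.Properties as ℤ
open import Data.Rational as ℚ using (ℚ; 0ℚ; 1ℚ; ½)
import Data.Rational.Properties as ℚ
open import Data.Rational.Solver using () renaming (module +-*-Solver to ℚS)
import Data.Rational.Unnormalised as ℚᵘ
import Data.Rational.Unnormalised.Properties as ℚᵘ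
open import Data.Fin using (Fin; zero; suc; toℕ)
import Data.Fin.Properties as Fin
open import Data.List using (List; []; _∷_; _++_; map; length; filter; upTo; concatMap; cartesianProductWith; lookup)
open import Data.List.Properties using (length-++; length-map; filter-accept; filter-reject)
open import Data.List.Membership.Propositional using (_∈_)
open import Data.List.Membership.Propositional.Properties using (∈-filter⁺; ∈-filter⁻; ∈-upTo⁺; ∈-upTo⁻; ∈-map⁺; ∈-++⁺ˡ; ∈-++⁺ʳ; ∈-concatMap⁺; ∈-cartesianProductWith⁺; ∈-lookup)
open import Data.List.Membership.Setoid.Properties using (index-injective)
open import Data.List.Relation.Unary.All as All using (All; []; _∷_)
import Data.List.Relation.Unary.All.Properties as All
open import Data.List.Relation.Unary.Any as Any using (here; there; index)
open import Data.List.Relation.Unary.AllPairs using ([]; _∷_)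
open import Data.List.Relation.Unary.Unique.Propositional using (Unique)
open import Data.List.Relation.Unary.Unique.Propositional.Properties using (upTo⁺; filter⁺)
import Data.Vec.Functional as V
open import Data.Product using (_×_; _,_; proj₁; proj₂; ∃-syntax; Σ-syntax)
open import Data.Sum using (_⊎_; inj₁; inj₂; reduce)
open import Data.Empty using (⊥)
open import Function using (_∘_)
open import Relation.Nullary using (¬_; Dec; yes; no; contradiction)
open import Relation.Nullary.Decidable using (¬?; decidable-stable; _×-dec_; _⊎-dec_; map′)
open import Relation.Unary using (Decidable)
open import Relation.Binary.Definitions using (tri<; tri≈; tri>)
open import Relation.Binary.PropositionalEquality

-- Maximal products with a given sum

-- The count rests on one fact about the lower convex hull of the graph of Q. A point strictly
-- inside an edge of it is never the first or last touching point of another line, because a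
-- supporting line that touches there contains the whole edge. So the widest chords have no inner
-- ends. A drop of the second partition at an inner point then tells the ray added for that point
-- from the widest chords and from the other added rays, and the widest chords (or `dg j` where no
-- chord exists) are told apart by the drop of the first partition at their middles. A line touches
-- at no more than m + 2 points: its two extreme ones and inner ones. These lie left of j, right of
-- j, or at j. A touching point at j stands for the single ray `dg j`, so it may be counted on the
-- right side without breaking the product bound. This is where d + 3 = (d + 1) + 2 comes from, and
-- the three floors are the parts of d + 3 when it is divided as evenly as possible.

4yz≤[y+z]² : ∀ y z → 4 * (y * z) ≤ (y + z) * (y + z)
4yz≤[y+z]² zero z = z≤n
4yz≤[y+z]² (suc y) zero rewrite *-zeroʳ y = z≤n
-- Both sides grow by 4 * (y + z + 1), because (y - z)² does not change.
4yz≤[y+z]² (suc y) (suc z) = subst₂ _≤_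
  (ℕS.solve 2 (λ y z → con 4 :* (y :* z) :+ con 4 :* (y :+ z :+ con 1)
     := con 4 :* ((con 1 :+ y) :* (con 1 :+ z))) refl y z)
  (ℕS.solve 2 (λ y z → (y :+ z) :* (y :+ z) :+ con 4 :* (y :+ z :+ con 1)
     := (con 1 :+ y :+ (con 1 :+ z)) :* (con 1 :+ y :+ (con 1 :+ z))) refl y z)
  (+-monoˡ-≤ (4 * (y + z + 1)) (4yz≤[y+z]² y z))
  where open ℕS

e₂ : ℕ → ℕ → ℕ → ℕ
e₂ x y z = x * y + y * z + z * x

e₃ : ℕ → ℕ → ℕ → ℕ
e₃ x y z = x * y * z

data Balanced : ℕ → ℕ → ℕ → Set where
  bal₀ : ∀ {a} → Balanced a a a
  bal₁ : ∀ {a} → Balanced a a (suc a)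
  bal₂ : ∀ {a} → Balanced a (suc a) (suc a)

-- Without the 3 this fails for the triple (0, 0, 1) and for no other. A remainder of up to 3 is
-- lost in the later division by 4.
balanced-square : ∀ {a b c} → Balanced a b c →
                  (a + b + c) * (a + b + c) ≤ 4 * e₂ a b c + 3
balanced-square {a} bal₀ = ≤-trans (m≤m+n _ (3 * (a * a) + 3)) (≤-reflexive
  (ℕS.solve 1 (λ a → (a :+ a :+ a) :* (a :+ a :+ a) :+ (con 3 :* (a :* a) :+ con 3)
     := con 4 :* (a :* a :+ a :* a :+ a :* a) :+ con 3) refl a))
  where open ℕS
balanced-square {a} bal₁ = ≤-trans (m≤m+n _ (3 * (a * a) + 2 * a + 2)) (≤-reflexive
  (ℕS.solve 1 (λ a → let s = con 1 :+ a in
     (a :+ a :+ s) :* (a :+ a :+ s) :+ (con 3 :* (a :* a) :+ con 2 :* a :+ con 2)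
     := con 4 :* (a :* a :+ a :* s :+ s :* a) :+ con 3) refl a))
  where open ℕS
balanced-square {a} bal₂ = ≤-trans (m≤m+n _ (3 * (a * a) + 4 * a + 3)) (≤-reflexive
  (ℕS.solve 1 (λ a → let s = con 1 :+ a in
     (a :+ s :+ s) :* (a :+ s :+ s) :+ (con 3 :* (a :* a) :+ con 4 :* a :+ con 3)
     := con 4 :* (a :* s :+ s :* s :+ s :* a) :+ con 3) refl a))
  where open ℕS

4m≤4n+3⇒m≤n : ∀ {m n} → 4 * m ≤ 4 * n + 3 → m ≤ n
4m≤4n+3⇒m≤n {m} {n} h = ≮⇒≥ λ n<m → <⇒≱ (begin-strict
  4 * n + 3  <⟨ n<1+n _ ⟩
  suc (4 * n + 3) ≡⟨ ℕS.solve 1 (λ n → con 1 :+ (con 4 :* n :+ con 3) := con 4 :* (con 1 :+ n)) refl n ⟩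
  4 * suc n  ≤⟨ *-monoʳ-≤ 4 n<m ⟩
  4 * m ∎) h
  where
  open ≤-Reasoning
  open ℕS

-- The base case of `balanced-max`: when one of three numbers is 0, their `e₂` is the product of the
-- other two.
balanced-pair : ∀ {a b c} y z → Balanced a b c → y + z ≤ a + b + c → y * z ≤ e₂ a b c
balanced-pair y z bal h = 4m≤4n+3⇒m≤n
  (≤-trans (4yz≤[y+z]² y z) (≤-trans (*-mono-≤ h h) (balanced-square bal)))

e₂-suc : ∀ x y z → e₂ (suc x) (suc y) (suc z) ≡ e₂ x y z + (2 * (x + y + z) + 3)
e₂-suc = ℕS.solve 3 (λ x y z → let s = con 1 :+ x; t = con 1 :+ y; u = con 1 :+ z in
  s :* t :+ t :* u :+ u :* s :=
  x :* y :+ y :* z :+ z :* x :+ (con 2 :* (x :+ y :+ z) :+ con 3)) refl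
  where open ℕS

e₃-suc : ∀ x y z → e₃ (suc x) (suc y) (suc z) ≡ e₃ x y z + (e₂ x y z + (x + y + z + 1))
e₃-suc = ℕS.solve 3 (λ x y z → (con 1 :+ x) :* (con 1 :+ y) :* (con 1 :+ z) :=
  x :* y :* z :+ (x :* y :+ y :* z :+ z :* x :+ (x :+ y :+ z :+ con 1))) refl
  where open ℕS

sum-suc : ∀ x y z → suc x + suc y + suc z ≡ 3 + (x + y + z)
sum-suc = ℕS.solve 3 (λ x y z → con 1 :+ x :+ (con 1 :+ y) :+ (con 1 :+ z) := con 3 :+ (x :+ y :+ z)) refl
  where open ℕS

-- Raising x, y, z by one adds to e₂ a multiple of the sum, and to e₃ a combination of e₂ and the
-- sum; so both bounds follow together from the same bounds for x - 1, y - 1, z - 1.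
balanced-max : ∀ {a b c} → Balanced a b c → ∀ x y z → x + y + z ≤ a + b + c →
               (e₂ x y z ≤ e₂ a b c) × (e₃ x y z ≤ e₃ a b c)
balanced-max {a} {b} {c} bal zero y z h =
    subst (_≤ e₂ a b c) (ℕS.solve 2 (λ y z → y :* z := y :* z :+ z :* con 0) refl y z)
      (balanced-pair y z bal h)
  , z≤n
  where open ℕS
balanced-max {a} {b} {c} bal x@(suc _) zero z h =
    subst (_≤ e₂ a b c) (ℕS.solve 2 (λ x z → x :* z := x :* con 0 :+ con 0 :* z :+ z :* x) refl x z)
      (balanced-pair x z bal (subst (λ n → n + z ≤ a + b + c) (+-identityʳ x) h))
  , subst (_≤ e₃ a b c) (sym (cong (_* z) (*-zeroʳ x))) z≤n
  where open ℕS
balanced-max {a} {b} {c} bal x@(suc _) y@(suc _) zero h =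
    subst (_≤ e₂ a b c) (ℕS.solve 2 (λ x y → x :* y := x :* y :+ y :* con 0 :+ con 0 :* x) refl x y)
      (balanced-pair x y bal (subst (_≤ a + b + c) (+-identityʳ (x + y)) h))
  , subst (_≤ e₃ a b c) (sym (*-zeroʳ (x * y))) z≤n
  where open ℕS
balanced-max bal (suc x) (suc y) (suc z) h = go bal h
  where
  step : ∀ {a b c} → Balanced a b c → suc x + suc y + suc z ≤ suc a + suc b + suc c →
         (e₂ (suc x) (suc y) (suc z) ≤ e₂ (suc a) (suc b) (suc c)) ×
         (e₃ (suc x) (suc y) (suc z) ≤ e₃ (suc a) (suc b) (suc c))
  step {a} {b} {c} bal h
    rewrite e₂-suc x y z | e₂-suc a b c | e₃-suc x y z | e₃-suc a b c =
      +-mono-≤ (proj₁ ih) (+-monoˡ-≤ 3 (*-monoʳ-≤ 2 h′))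
    , +-mono-≤ (proj₂ ih) (+-mono-≤ (proj₁ ih) (+-monoˡ-≤ 1 h′))
    where
    h′ : x + y + z ≤ a + b + c
    h′ = +-cancelˡ-≤ 3 _ _ (subst₂ _≤_ (sum-suc x y z) (sum-suc a b c) h)
    ih = balanced-max bal x y z h′
  -- A balanced triple with least entry 0 has sum at most 2, too small for three positive numbers.
  small : ∀ {n} → suc x + suc y + suc z ≤ n → n ≤ 2 → ∀ {ℓ} {A : Set ℓ} → A
  small {n} h h2 with subst (_≤ 2) (sum-suc x y z) (≤-trans h h2)
  ... | s≤s (s≤s ())
  go : ∀ {a b c} → Balanced a b c → suc x + suc y + suc z ≤ a + b + c →
       (e₂ (suc x) (suc y) (suc z) ≤ e₂ a b c) × (e₃ (suc x) (suc y) (suc z) ≤ e₃ a b c)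
  go {zero}  bal₀ h = small h z≤n
  go {zero}  bal₁ h = small h (s≤s z≤n)
  go {zero}  bal₂ h = small h (s≤s (s≤s z≤n))
  go {suc a} bal₀ h = step bal₀ h
  go {suc a} bal₁ h = step bal₁ h
  go {suc a} bal₂ h = step bal₂ h

[s+q*3]/3 : ∀ s q → (s + q * 3) / 3 ≡ s / 3 + q
[s+q*3]/3 s q = trans (+-distrib-/-∣ʳ s (n∣m*n q)) (cong (s / 3 +_) (m*n/n≡m q 3))

-- Write n = s + 3q with s < 3: the remainder s is the number of the three floors that equal q + 1
-- instead of q.
thirds : ∀ n → ∃[ a ] ∃[ b ] ∃[ c ]
  (n / 3 ≡ a × (n + 1) / 3 ≡ b × (n + 2) / 3 ≡ c × Balanced a b c × n ≡ a + b + c)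
thirds n = subst Thirds (sym (m≡m%n+[m/n]*n n 3)) (go (n % 3) (m%n<n n 3) (n / 3))
  where
  Thirds : ℕ → Set
  Thirds n = ∃[ a ] ∃[ b ] ∃[ c ]
    (n / 3 ≡ a × (n + 1) / 3 ≡ b × (n + 2) / 3 ≡ c × Balanced a b c × n ≡ a + b + c)
  shift : ∀ s q t → (s + q * 3 + t) / 3 ≡ (s + t) / 3 + q
  shift s q t = trans (cong (_/ 3) (trans (+-assoc s (q * 3) t)
      (trans (cong (s +_) (+-comm (q * 3) t)) (sym (+-assoc s t (q * 3))))))
    ([s+q*3]/3 (s + t) q)
  open ℕS
  go : ∀ s → s < 3 → ∀ q → Thirds (s + q * 3)
  go 0 _ q = q , q , q , [s+q*3]/3 0 q , shift 0 q 1 , shift 0 q 2 , bal₀ ,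
    ℕS.solve 1 (λ q → q :* con 3 := q :+ q :+ q) refl q
  go 1 _ q = q , q , suc q , [s+q*3]/3 1 q , shift 1 q 1 , shift 1 q 2 , bal₁ ,
    ℕS.solve 1 (λ q → con 1 :+ q :* con 3 := q :+ q :+ (con 1 :+ q)) refl q
  go 2 _ q = q , suc q , suc q , [s+q*3]/3 2 q , shift 2 q 1 , shift 2 q 2 , bal₂ ,
    ℕS.solve 1 (λ q → con 2 :+ q :* con 3 := q :+ (con 1 :+ q) :+ (con 1 :+ q)) refl q
  go (suc (suc (suc s))) (s≤s (s≤s (s≤s ()))) q

xyz≤thirds : ∀ d x y z → x + y + z ≤ d + 3 →
             x * y * z ≤ ((d + 3) / 3) * ((d + 4) / 3) * ((d + 5) / 3)
xyz≤thirds d x y z h with thirds (d + 3)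
... | a , b , c , refl , eb , ec , bal , eq
  rewrite sym (+-assoc d 3 1) | sym (+-assoc d 3 2) | eb | ec =
  proj₂ (balanced-max bal x y z (subst (x + y + z ≤_) eq h))

-- Kostka pairs and their extremal rays

-- ind j is the partition (1, …, 1, 0, …) with j ones.
ind : ℕ → ℕ → ℕ
ind zero    n       = 0
ind (suc j) zero    = 1
ind (suc j) (suc n) = ind j n

ind-< : ∀ {j n} → n < j → ind j n ≡ 1
ind-< {suc j} {zero}  _         = refl
ind-< {suc j} {suc n} (s≤s n<j) = ind-< n<j

ind-≥ : ∀ {j n} → j ≤ n → ind j n ≡ 0
ind-≥ {zero}          _         = refl
ind-≥ {suc j} {suc n} (s≤s j≤n) = ind-≥ j≤n

ind-≤1 : ∀ j n → ind j n ≤ 1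
ind-≤1 zero    n       = z≤n
ind-≤1 (suc j) zero    = ≤-refl
ind-≤1 (suc j) (suc n) = ind-≤1 j n

ind-anti : ∀ j n → ind j (suc n) ≤ ind j n
ind-anti zero    n       = z≤n
ind-anti (suc j) zero    = ind-≤1 j 0
ind-anti (suc j) (suc n) = ind-anti j n

ind-flat : ∀ {j n} → suc n ≢ j → ind j (suc n) ≡ ind j n
ind-flat {zero}        ≢ = refl
ind-flat {suc zero}    {zero}  ≢ = contradiction refl ≢
ind-flat {suc (suc j)} {zero}  ≢ = refl
ind-flat {suc j}       {suc n} ≢ = ind-flat (≢ ∘ cong suc)

-- Partial sums and concavity.

psum : (ℕ → ℕ) → ℕ → ℕ
psum f zero    = 0
psum f (suc n) = psum f n + f n

psum-cong : ∀ {f g} → (∀ n → f n ≡ g n) → ∀ x → psum f x ≡ psum g x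
psum-cong h zero    = refl
psum-cong h (suc x) = cong₂ _+_ (psum-cong h x) (h x)

psum-+ : ∀ f g x → psum (λ n → f n + g n) x ≡ psum f x + psum g x
psum-+ f g zero    = refl
psum-+ f g (suc x) rewrite psum-+ f g x =
  ℕS.solve 4 (λ a b c d → a :+ b :+ (c :+ d) := a :+ c :+ (b :+ d)) refl (psum f x) (psum g x) (f x) (g x)
  where open ℕS

psum-* : ∀ c f x → psum (λ n → c * f n) x ≡ c * psum f x
psum-* c f zero    = sym (*-zeroʳ c)
psum-* c f (suc x) rewrite psum-* c f x = sym (*-distribˡ-+ c (psum f x) (f x))

psum-mono : ∀ f {x y} → x ≤ y → psum f x ≤ psum f y
psum-mono f {x} {zero} z≤n = z≤n
psum-mono f {x} {suc y} x≤1+y with x ≟ suc y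
... | yes refl = ≤-refl
... | no  x≢   = ≤-trans (psum-mono f (≤-pred (≤∧≢⇒< x≤1+y x≢))) (m≤m+n _ _)

psum-flat : ∀ f {x y} → x ≤ y → (∀ n → x ≤ n → f n ≡ 0) → psum f y ≡ psum f x
psum-flat f {x} {zero} z≤n _ = refl
psum-flat f {x} {suc y} x≤1+y h with x ≟ suc y
... | yes refl = refl
... | no  x≢   = trans (cong₂ _+_ (psum-flat f x≤y h) (h y x≤y)) (+-identityʳ _)
  where x≤y = ≤-pred (≤∧≢⇒< x≤1+y x≢)

psum-ind-≤ : ∀ {j x} → x ≤ j → psum (ind j) x ≡ x
psum-ind-≤ {x = zero}  _   = refl
psum-ind-≤ {x = suc x} x<j = trans (cong₂ _+_ (psum-ind-≤ (<⇒≤ x<j)) (ind-< x<j)) (+-comm x 1)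

psum-ind-≥ : ∀ {j x} → j ≤ x → psum (ind j) x ≡ j
psum-ind-≥ {j} j≤x = trans (psum-flat (ind j) j≤x (λ _ → ind-≥)) (psum-ind-≤ ≤-refl)

Antitone : (ℕ → ℕ) → Set
Antitone f = ∀ n → f (suc n) ≤ f n

antitone-≤ : ∀ {f} → Antitone f → ∀ {x y} → x ≤ y → f y ≤ f x
antitone-≤ anti {zero}  {zero}  _ = ≤-refl
antitone-≤ anti {x}     {suc y} x≤1+y with x ≟ suc y
... | yes refl = ≤-refl
... | no  x≢   = ≤-trans (anti y) (antitone-≤ anti (≤-pred (≤∧≢⇒< x≤1+y x≢)))

vanish : ∀ {f x} → Antitone f → f x ≡ 0 → ∀ n → x ≤ n → f n ≡ 0
vanish {f} anti e n x≤n = n≤0⇒n≡0 (subst (f n ≤_) e (antitone-≤ anti x≤n))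

-- psum f is concave, and psum g is affine on [i , j].
concave-above : ∀ {f g i j c} → Antitone f → (∀ n → i ≤ n → n < j → g n ≡ c) →
  psum g i ≤ psum f i → psum g j ≤ psum f j →
  ∀ x → i ≤ x → x ≤ j → psum g x ≤ psum f x
concave-above {f} {g} {i} {j} {c} anti flat ≤i ≤j x i≤x x≤j with c ≤? f x
-- If f x ≥ c, then f ≥ c on [i , x], so the gap `psum f - psum g` does not shrink from i to x.
-- Otherwise f < c from x on, so the gap does not grow from x to j, and it is still nonnegative at
-- j.
... | yes c≤fx = up x i≤x ≤-refl
  where
  up : ∀ y → i ≤ y → y ≤ x → psum g y ≤ psum f y
  up zero z≤n _ = ≤i
  up (suc y) i≤1+y y<x with i ≟ suc y
  ... | yes refl = ≤i
  ... | no  i≢   = +-mono-≤ (up y i≤y (<⇒≤ y<x))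
      (subst (_≤ f y) (sym (flat y i≤y (<-≤-trans y<x x≤j)))
        (≤-trans c≤fx (antitone-≤ anti (<⇒≤ y<x))))
    where i≤y = ≤-pred (≤∧≢⇒< i≤1+y i≢)
... | no c≰fx = +-cancelʳ-≤ (psum f j) _ _
  (≤-trans (gap j x≤j ≤-refl) (+-monoʳ-≤ (psum f x) ≤j))
  where
  gap : ∀ y → x ≤ y → y ≤ j → psum g x + psum f y ≤ psum f x + psum g y
  gap zero z≤n _ = ≤-refl
  gap (suc y) x≤1+y y<j with x ≟ suc y
  ... | yes refl = ≤-reflexive (+-comm (psum g x) (psum f x))
  ... | no  x≢   = subst₂ _≤_ (+-assoc (psum g x) (psum f y) (f y)) (+-assoc (psum f x) (psum g y) (g y))
      (+-mono-≤ (gap y x≤y (<⇒≤ y<j))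
        (subst (f y ≤_) (sym (flat y (≤-trans i≤x x≤y) y<j))
          (≤-trans (antitone-≤ anti x≤y) (<⇒≤ (≰⇒> c≰fx)))))
    where x≤y = ≤-pred (≤∧≢⇒< x≤1+y x≢)

-- Partitions are sequences on all of ℕ that vanish from r on. The last drop, from index r - 1 to r,
-- is then a drop like any other.
record KostkaPair (r : ℕ) (l m : ℕ → ℕ) : Set where
  field
    l-anti : Antitone l
    m-anti : Antitone m
    l-end  : l r ≡ 0
    m-end  : m r ≡ 0
    total  : psum l r ≡ psum m r
    dom    : ∀ x → x ≤ r → psum m x ≤ psum l x

-- The extremal rays: dg j is the pair (ind j, ind j), and tr i j k with i < j < k is the
-- pair ((k - i) ind j, (k - j) ind i + (j - i) ind k).
data Ray : Set where
  dg : ℕ → Ray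
  tr : ℕ → ℕ → ℕ → Ray

-- `dg j` is read as the degenerate chord with both ends at j and weights 1 and 0, so that both
-- kinds of ray share one formula: the middle is the barycentre of the two ends.
mid left right wl wr w : Ray → ℕ
mid   (dg j)     = j
mid   (tr i j k) = j
left  (dg j)     = j
left  (tr i j k) = i
right (dg j)     = j
right (tr i j k) = k
wl    (dg j)     = 1
wl    (tr i j k) = k ∸ j
wr    (dg j)     = 0
wr    (tr i j k) = j ∸ i
w t = wl t + wr t

Ok : ℕ → Ray → Set
Ok r (dg j)     = 1 ≤ j × j ≤ r
Ok r (tr i j k) = i < j × j < k × k ≤ r

upper lower : Ray → ℕ → ℕ
upper t n = w t * ind (mid t) n
lower t n = wl t * ind (left t) n + wr t * ind (right t) n

-- The barycentre identity. It gives both partitions of a ray the same total, and in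
-- `pairing-excess` it reduces an affine function on the ends to its value at the middle.
balance : ∀ {r} t → Ok r t → w t * mid t ≡ wl t * left t + wr t * right t
balance (dg j) _ = sym (+-identityʳ (1 * j))
balance (tr i j k) (i<j , j<k , _) = begin
  (a + b) * j             ≡⟨ cong ((a + b) *_) (sym bi≡j) ⟩
  (a + b) * (b + i)       ≡⟨ ℕS.solve 3 (λ a b i → (a :+ b) :* (b :+ i) := a :* i :+ b :* (a :+ (b :+ i))) refl a b i ⟩
  a * i + b * (a + (b + i)) ≡⟨ cong (λ n → a * i + b * n) (trans (cong (a +_) bi≡j) (m∸n+n≡m (<⇒≤ j<k))) ⟩
  a * i + b * k           ∎
  where
  open ≡-Reasoning
  open ℕS
  a = k ∸ j
  b = j ∸ i
  bi≡j : b + i ≡ j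
  bi≡j = m∸n+n≡m (<⇒≤ i<j)

w>0 : ∀ {r} t → Ok r t → 0 < w t
w>0 (dg j)     _               = s≤s z≤n
w>0 (tr i j k) (i<j , j<k , _) = ≤-trans (m<n⇒0<n∸m j<k) (m≤m+n (k ∸ j) (j ∸ i))

mid>0 : ∀ {r} t → Ok r t → 0 < mid t
mid>0 (dg j)     (1≤j , _) = 1≤j
mid>0 (tr i j k) (i<j , _) = ≤-trans (s≤s z≤n) i<j

left≤mid : ∀ {r} t → Ok r t → left t ≤ mid t
left≤mid (dg j)     _         = ≤-refl
left≤mid (tr i j k) (i<j , _) = <⇒≤ i<j

mid≤right : ∀ {r} t → Ok r t → mid t ≤ right t
mid≤right (dg j)     _             = ≤-refl
mid≤right (tr i j k) (_ , j<k , _) = <⇒≤ j<k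

right≤r : ∀ {r} t → Ok r t → right t ≤ r
right≤r (dg j)     (_ , j≤r)     = j≤r
right≤r (tr i j k) (_ , _ , k≤r) = k≤r

psum-upper : ∀ t x → psum (upper t) x ≡ w t * psum (ind (mid t)) x
psum-upper t = psum-* (w t) (ind (mid t))

psum-lower : ∀ t x → psum (lower t) x ≡ wl t * psum (ind (left t)) x + wr t * psum (ind (right t)) x
psum-lower t x = trans (psum-+ (λ n → wl t * ind (left t) n) (λ n → wr t * ind (right t) n) x)
  (cong₂ _+_ (psum-* (wl t) (ind (left t)) x) (psum-* (wr t) (ind (right t)) x))

module _ {r : ℕ} (t : Ray) (ok : Ok r t) where

  private
    i≤j = left≤mid t ok
    j≤k = mid≤right t ok
    k≤r = right≤r t ok

  psum-upper-total : psum (upper t) r ≡ w t * mid t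
  psum-upper-total = trans (psum-upper t r) (cong (w t *_) (psum-ind-≥ (≤-trans j≤k k≤r)))

  psum-lower-total : psum (lower t) r ≡ w t * mid t
  psum-lower-total = begin
    psum (lower t) r ≡⟨ psum-lower t r ⟩
    wl t * psum (ind (left t)) r + wr t * psum (ind (right t)) r
      ≡⟨ cong₂ (λ a b → wl t * a + wr t * b) (psum-ind-≥ (≤-trans i≤j (≤-trans j≤k k≤r))) (psum-ind-≥ k≤r) ⟩
    wl t * left t + wr t * right t ≡⟨ sym (balance t ok) ⟩
    w t * mid t ∎
    where open ≡-Reasoning

  ray-pair : KostkaPair r (upper t) (lower t)
  ray-pair = record
    { l-anti = λ n → *-monoʳ-≤ (w t) (ind-anti (mid t) n)
    ; m-anti = λ n → +-mono-≤ (*-monoʳ-≤ (wl t) (ind-anti (left t) n)) (*-monoʳ-≤ (wr t) (ind-anti (right t) n))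
    ; l-end  = trans (cong (w t *_) (ind-≥ (≤-trans j≤k k≤r))) (*-zeroʳ (w t))
    ; m-end  = trans (cong₂ (λ a b → wl t * a + wr t * b) (ind-≥ (≤-trans i≤j (≤-trans j≤k k≤r))) (ind-≥ k≤r))
                 (cong₂ _+_ (*-zeroʳ (wl t)) (*-zeroʳ (wr t)))
    ; total  = trans psum-upper-total (sym psum-lower-total)
    ; dom    = dominance
    }
    where
    ind-total≤ : ∀ j x → psum (ind j) x ≤ x
    ind-total≤ j zero    = z≤n
    ind-total≤ j (suc x) = subst (psum (ind j) x + ind j x ≤_) (+-comm x 1) (+-mono-≤ (ind-total≤ j x) (ind-≤1 j x))
    dominance : ∀ x → x ≤ r → psum (lower t) x ≤ psum (upper t) x
    -- Up to the middle the upper sum is `w t * x`, the most that total weight `w t` allows; after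
    -- it the upper sum has reached the common total.
    dominance x x≤r with x ≤? mid t
    ... | yes x≤j rewrite psum-lower t x | psum-upper t x | psum-ind-≤ x≤j = begin
      wl t * psum (ind (left t)) x + wr t * psum (ind (right t)) x
        ≤⟨ +-mono-≤ (*-monoʳ-≤ (wl t) (ind-total≤ (left t) x)) (*-monoʳ-≤ (wr t) (ind-total≤ (right t) x)) ⟩
      wl t * x + wr t * x ≡⟨ sym (*-distribʳ-+ x (wl t) (wr t)) ⟩
      w t * x ∎
      where open ≤-Reasoning
    ... | no x≰j = begin
      psum (lower t) x ≤⟨ psum-mono (lower t) x≤r ⟩
      psum (lower t) r ≡⟨ psum-lower-total ⟩
      w t * mid t      ≡⟨ cong (w t *_) (sym (psum-ind-≥ (<⇒≤ (≰⇒> x≰j)))) ⟩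
      w t * psum (ind (mid t)) x ≡⟨ sym (psum-upper t x) ⟩
      psum (upper t) x ∎
      where open ≤-Reasoning

  -- The ray is taken once from `w t` copies of (l , m), which keeps everything integral. Since
  -- `upper t` is `w t` times an indicator, the first partition just loses 1 from each nonzero entry
  -- before scaling. The second must drop at both ends of the chord, where `lower t` drops, and be
  -- constant between them.
  module Subtract {l m : ℕ → ℕ} (lm : KostkaPair r l m)
    (l>0   : ∀ n → n < mid t → 0 < l n)
    (l-mid : l (mid t) ≡ 0)
    (m>0   : ∀ n → n < right t → 0 < m n)
    (kinkˡ : ∀ n → suc n ≡ left t → m (suc n) < m n)
    (kinkʳ : ∀ n → suc n ≡ right t → m (suc n) < m n)
    (c : ℕ) (flat : ∀ n → left t ≤ n → n < right t → m n ≡ c) where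

    open KostkaPair lm

    l′ m′ : ℕ → ℕ
    l′ n = w t * (l n ∸ 1)
    m′ n = w t * m n ∸ lower t n

    l-split : ∀ n → w t * l n ≡ upper t n + l′ n
    l-split n with suc n ≤? mid t
    ... | yes n<j rewrite ind-< n<j = trans (cong (w t *_) (sym (m+[n∸m]≡n (l>0 n n<j)))) (*-distribˡ-+ (w t) 1 (l n ∸ 1))
    ... | no  n≮j rewrite ind-≥ (≮⇒≥ n≮j) | vanish l-anti l-mid n (≮⇒≥ n≮j) | *-zeroʳ (w t) = refl

    lower≤w : ∀ n → lower t n ≤ w t
    lower≤w n = subst (lower t n ≤_) (cong₂ _+_ (*-identityʳ (wl t)) (*-identityʳ (wr t)))
      (+-mono-≤ (*-monoʳ-≤ (wl t) (ind-≤1 (left t) n)) (*-monoʳ-≤ (wr t) (ind-≤1 (right t) n)))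

    m-split : ∀ n → w t * m n ≡ lower t n + m′ n
    m-split n = sym (m+[n∸m]≡n bound)
      where
      bound : lower t n ≤ w t * m n
      bound with suc n ≤? right t
      ... | yes n<k = ≤-trans (lower≤w n) (subst (_≤ w t * m n) (*-identityʳ (w t)) (*-monoʳ-≤ (w t) (m>0 n n<k)))
      ... | no  n≮k rewrite ind-≥ (≮⇒≥ n≮k) | ind-≥ {left t} {n} (≤-trans i≤j (≤-trans j≤k (≮⇒≥ n≮k)))
        | *-zeroʳ (wl t) | *-zeroʳ (wr t) = z≤n

    -- A drop of m by 1 becomes a drop by `w t` after scaling, and no value of `lower t` exceeds
    -- `w t`.
    m′-kink : ∀ n → m (suc n) < m n → m′ (suc n) ≤ m′ n
    m′-kink n h = begin
      w t * m (suc n) ∸ lower t (suc n) ≤⟨ m∸n≤m _ (lower t (suc n)) ⟩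
      w t * m (suc n)                   ≡⟨ sym (m+n∸m≡n (w t) _) ⟩
      (w t + w t * m (suc n)) ∸ w t     ≡⟨ cong (_∸ w t) (sym (*-suc (w t) (m (suc n)))) ⟩
      w t * suc (m (suc n)) ∸ w t       ≤⟨ ∸-mono (*-monoʳ-≤ (w t) h) (lower≤w n) ⟩
      w t * m n ∸ lower t n             ∎
      where open ≤-Reasoning

    m′-anti : Antitone m′
    m′-anti n with suc n ≟ left t | suc n ≟ right t
    ... | yes ≡i | _      = m′-kink n (kinkˡ n ≡i)
    ... | no  _  | yes ≡k = m′-kink n (kinkʳ n ≡k)
    ... | no  ≢i | no  ≢k = subst (λ s → w t * m (suc n) ∸ s ≤ m′ n)
      (sym (cong₂ (λ a b → wl t * a + wr t * b) (ind-flat ≢i) (ind-flat ≢k)))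
      (∸-monoˡ-≤ (lower t n) (*-monoʳ-≤ (w t) (m-anti n)))

    psum-l-split : ∀ x → w t * psum l x ≡ psum (upper t) x + psum l′ x
    psum-l-split x = trans (sym (psum-* (w t) l x)) (trans (psum-cong l-split x) (psum-+ (upper t) l′ x))

    psum-m-split : ∀ x → w t * psum m x ≡ psum (lower t) x + psum m′ x
    psum-m-split x = trans (sym (psum-* (w t) m x)) (trans (psum-cong m-split x) (psum-+ (lower t) m′ x))

    l′-anti : Antitone l′
    l′-anti n = *-monoʳ-≤ (w t) (∸-monoˡ-≤ 1 (l-anti n))

    l′-vanish : ∀ n → mid t ≤ n → l′ n ≡ 0
    l′-vanish n j≤n = trans (cong (λ y → w t * (y ∸ 1)) (vanish l-anti l-mid n j≤n)) (*-zeroʳ (w t))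

    total′ : psum l′ r ≡ psum m′ r
    total′ = +-cancelˡ-≡ (w t * mid t) _ _ (begin
      w t * mid t + psum l′ r         ≡⟨ cong (_+ psum l′ r) (sym psum-upper-total) ⟩
      psum (upper t) r + psum l′ r    ≡⟨ sym (psum-l-split r) ⟩
      w t * psum l r                  ≡⟨ cong (w t *_) total ⟩
      w t * psum m r                  ≡⟨ psum-m-split r ⟩
      psum (lower t) r + psum m′ r    ≡⟨ cong (_+ psum m′ r) psum-lower-total ⟩
      w t * mid t + psum m′ r         ∎)
      where open ≡-Reasoning

    remainder : KostkaPair r l′ m′
    remainder = record
      { l-anti = l′-anti
      ; m-anti = m′-anti
      ; l-end  = l′-vanish r (≤-trans j≤k k≤r)
      ; m-end  = trans (cong (λ y → w t * y ∸ lower t r) m-end) (trans (cong (_∸ lower t r) (*-zeroʳ (w t))) (0∸n≡0 (lower t r)))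
      ; total  = total′
      ; dom    = dominance
      }
      where
      open ≤-Reasoning
      below-left : ∀ x → x ≤ left t → psum m′ x ≤ psum l′ x
      below-left x x≤i = +-cancelˡ-≤ (w t * x) _ _ (begin
        w t * x + psum m′ x            ≡⟨ cong (_+ psum m′ x) (sym lower-x) ⟩
        psum (lower t) x + psum m′ x   ≡⟨ sym (psum-m-split x) ⟩
        w t * psum m x                 ≤⟨ *-monoʳ-≤ (w t) (dom x (≤-trans x≤i (≤-trans i≤j (≤-trans j≤k k≤r)))) ⟩
        w t * psum l x                 ≡⟨ psum-l-split x ⟩
        psum (upper t) x + psum l′ x   ≡⟨ cong (_+ psum l′ x) (trans (psum-upper t x) (cong (w t *_) (psum-ind-≤ (≤-trans x≤i i≤j)))) ⟩
        w t * x + psum l′ x            ∎)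
        where
        lower-x : psum (lower t) x ≡ w t * x
        lower-x = trans (psum-lower t x)
          (trans (cong₂ (λ a b → wl t * a + wr t * b) (psum-ind-≤ x≤i) (psum-ind-≤ (≤-trans x≤i (≤-trans i≤j j≤k))))
            (sym (*-distribʳ-+ x (wl t) (wr t))))
      above-mid : ∀ x → mid t ≤ x → x ≤ r → psum m′ x ≤ psum l′ x
      above-mid x j≤x x≤r = begin
        psum m′ x ≤⟨ psum-mono m′ x≤r ⟩
        psum m′ r ≡⟨ sym total′ ⟩
        psum l′ r ≡⟨ psum-flat l′ x≤r (λ n x≤n → l′-vanish n (≤-trans j≤x x≤n)) ⟩
        psum l′ x ∎
      flat′ : ∀ n → left t ≤ n → n < mid t → m′ n ≡ w t * c ∸ wr t
      flat′ n i≤n n<j = cong₂ _∸_ (cong (w t *_) (flat n i≤n (<-≤-trans n<j j≤k)))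
        (trans (cong₂ (λ a b → wl t * a + wr t * b) (ind-≥ i≤n) (ind-< (<-≤-trans n<j j≤k)))
          (cong₂ _+_ (*-zeroʳ (wl t)) (*-identityʳ (wr t))))
      -- Up to the left end both subtracted sums are `w t * x`; from the middle on l′ is exhausted.
      -- Between the two, m′ is constant, so its sums are affine and lie below the concave sums of
      -- l′ because they do so at both ends.
      dominance : ∀ x → x ≤ r → psum m′ x ≤ psum l′ x
      dominance x x≤r with x ≤? left t | mid t ≤? x
      ... | yes x≤i | _       = below-left x x≤i
      ... | no  _   | yes j≤x = above-mid x j≤x x≤r
      ... | no  x≰i | no  j≰x = concave-above l′-anti flat′ (below-left _ ≤-refl)
        (above-mid _ ≤-refl (≤-trans j≤k k≤r)) x (<⇒≤ (≰⇒> x≰i)) (<⇒≤ (≰⇒> j≰x))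

-- Splitting a ray off a Kostka pair.

record RaySplit (r : ℕ) (l m : ℕ → ℕ) : Set where
  constructor mkSplit
  field
    ray     : Ray
    ok      : Ok r ray
    l′ m′   : ℕ → ℕ
    pair    : KostkaPair r l′ m′
    l-split : ∀ n → w ray * l n ≡ upper ray n + l′ n
    m-split : ∀ n → w ray * m n ≡ lower ray n + m′ n

last-true : ∀ {P : ℕ → Set} → Decidable P → ∀ {a b} → a ≤ b → P a → ¬ P b →
            ∃[ n ] (a ≤ n × n < b × P n × ¬ P (suc n))
last-true P? {zero} {zero}  z≤n  pa ¬pb = contradiction pa ¬pb
last-true P? {a}    {suc b} a≤1+b pa ¬pb with a ≟ suc b
... | yes refl = contradiction pa ¬pb
... | no  a≢ with P? b
...   | yes pb = b , ≤-pred (≤∧≢⇒< a≤1+b a≢) , ≤-refl , pb , ¬pb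
...   | no ¬pb′ with last-true P? (≤-pred (≤∧≢⇒< a≤1+b a≢)) pa ¬pb′
...     | n , a≤n , n<b , pn , ¬pn = n , a≤n , m<n⇒m<1+n n<b , pn , ¬pn

-- The ray is tr i j k, where j is the length of l and [i , k) is the level set of m that contains
-- j - 1; if k = j it is dg j instead.
split-ray : ∀ {r l m} → KostkaPair r l m → 0 < l 0 → RaySplit r l m
split-ray {r} {l} {m} lm l0>0
  with last-true (λ n → 1 ≤? l n) {0} {r} z≤n l0>0 (subst (¬_ ∘ (0 <_)) (sym (KostkaPair.l-end lm)) λ ())
... | p , _ , p<r , lp>0 , l[1+p]≯0
  with last-true (λ n → m n ≟ m p) (<⇒≤ p<r) refl (λ eq → <⇒≢ m-p>0 (trans (sym m-end) eq))
  where
  open KostkaPair lm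
  open ≤-Reasoning
  -- If m vanished at p, its total would be reached at p and hence be at most `psum l p`, which is
  -- less than the total of l.
  m-p>0 : 0 < m p
  m-p>0 = ≰⇒> λ mp≤0 → <-irrefl refl (begin-strict
    psum l p       <⟨ m<m+n (psum l p) lp>0 ⟩
    psum l (suc p) ≤⟨ psum-mono l p<r ⟩
    psum l r       ≡⟨ total ⟩
    psum m r       ≡⟨ psum-flat m (<⇒≤ p<r) (vanish m-anti (n≤0⇒n≡0 mp≤0)) ⟩
    psum m p       ≤⟨ dom p (<⇒≤ p<r) ⟩
    psum l p       ∎)
... | q , p≤q , q<r , mq≡ , m[1+q]≢ = result
  where
  open KostkaPair lm
  l-mid : l (suc p) ≡ 0
  l-mid = n≤0⇒n≡0 (≮⇒≥ l[1+p]≯0)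
  l>0 : ∀ n → n < suc p → 0 < l n
  l>0 n n<1+p = <-≤-trans lp>0 (antitone-≤ l-anti (≤-pred n<1+p))
  drop : m (suc q) < m q
  drop = ≤∧≢⇒< (m-anti q) λ eq → m[1+q]≢ (trans eq mq≡)
  m>0 : ∀ n → n < suc q → 0 < m n
  m>0 n n<1+q = ≤-<-trans z≤n (<-≤-trans drop (antitone-≤ m-anti (≤-pred n<1+q)))
  kinkʳ : ∀ n → suc n ≡ suc q → m (suc n) < m n
  kinkʳ n refl = drop
  build : ∀ t (ok : Ok r t) → mid t ≡ suc p → right t ≡ suc q →
          (∀ n → suc n ≡ left t → m (suc n) < m n) →
          (∀ n → left t ≤ n → n < right t → m n ≡ m p) → RaySplit r l m
  build t ok ej ek kinkˡ flat = mkSplit t ok _ _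
    S.remainder S.l-split S.m-split
    where
    module S = Subtract t ok lm
      (λ n h → l>0 n (subst (n <_) ej h)) (trans (cong l ej) l-mid)
      (λ n h → m>0 n (subst (n <_) ek h)) kinkˡ (λ n h → kinkʳ n (trans h ek)) (m p) flat
  flat-from : ∀ i → m i ≡ m p → ∀ n → i ≤ n → n < suc q → m n ≡ m p
  flat-from i mi n i≤n n<1+q = ≤-antisym (subst (m n ≤_) mi (antitone-≤ m-anti i≤n))
    (subst (_≤ m n) mq≡ (antitone-≤ m-anti (≤-pred n<1+q)))
  result : RaySplit r l m
  result with p ≟ q
  ... | yes refl = build (dg (suc p)) (s≤s z≤n , p<r) refl refl kinkʳ
        (λ n a b → contradiction (<-≤-trans b a) (<-irrefl refl))
  ... | no p≢q with m 0 ≟ m p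
  -- A level set that starts at 0 has left end 0; as `ind 0` is zero, no drop of m is required
  -- there.
  ...   | yes m0≡ = build (tr 0 (suc p) (suc q)) (s≤s z≤n , s≤s (≤∧≢⇒< p≤q p≢q) , q<r) refl refl (λ _ ())
          (flat-from 0 m0≡)
  ...   | no m0≢ with last-true (λ n → ¬? (m n ≟ m p)) {0} {p} z≤n m0≢ (λ ne → ne refl)
  ...     | s , _ , s<p , ms≢ , ¬ms≢ =
            build (tr (suc s) (suc p) (suc q)) (s≤s s<p , s≤s (≤∧≢⇒< p≤q p≢q) , q<r) refl refl
              (λ { n refl → ≤∧≢⇒< (m-anti s) (λ eq → ms≢ (trans (sym eq) ms≡)) })
              (flat-from (suc s) ms≡)
    where
    ms≡ : m (suc s) ≡ m p
    ms≡ = decidable-stable (m (suc s) ≟ m p) ¬ms≢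

-- Rational arithmetic

+-nonNeg : ∀ {p q} → 0ℚ ℚ.≤ p → 0ℚ ℚ.≤ q → 0ℚ ℚ.≤ p ℚ.+ q
+-nonNeg = ℚ.+-mono-≤

*-nonNeg : ∀ {p q} → 0ℚ ℚ.≤ p → 0ℚ ℚ.≤ q → 0ℚ ℚ.≤ p ℚ.* q
*-nonNeg {p} {q} 0≤p 0≤q = ℚ.nonNegative⁻¹ (p ℚ.* q)
  {{ℚ.nonNeg*nonNeg⇒nonNeg p {{ℚ.nonNegative 0≤p}} q {{ℚ.nonNegative 0≤q}}}}

*-pos : ∀ {p q} → 0ℚ ℚ.< p → 0ℚ ℚ.< q → 0ℚ ℚ.< p ℚ.* q
*-pos {p} {q} 0<p 0<q = ℚ.positive⁻¹ (p ℚ.* q)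
  {{ℚ.pos*pos⇒pos p {{ℚ.positive 0<p}} q {{ℚ.positive 0<q}}}}

pos-cancel-≤ : ∀ {p q} → 0ℚ ℚ.< p → 0ℚ ℚ.≤ p ℚ.* q → 0ℚ ℚ.≤ q
pos-cancel-≤ {p} {q} 0<p 0≤pq =
  ℚ.*-cancelˡ-≤-pos p {{ℚ.positive 0<p}} (subst (ℚ._≤ p ℚ.* q) (sym (ℚ.*-zeroʳ p)) 0≤pq)

p≤q⇒0≤q-p : ∀ {p q} → p ℚ.≤ q → 0ℚ ℚ.≤ q ℚ.- p
p≤q⇒0≤q-p {p} {q} p≤q = subst (ℚ._≤ q ℚ.- p) (ℚ.+-inverseʳ p) (ℚ.+-monoˡ-≤ (ℚ.- p) p≤q)

pos⇒inverse : ∀ {p} → 0ℚ ℚ.< p → ∃[ q ] (0ℚ ℚ.< q × p ℚ.* q ≡ 1ℚ)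
pos⇒inverse {p} 0<p =
  (ℚ.1/ p) {{p≢0}} , ℚ.positive⁻¹ _ {{ℚ.1/pos⇒pos p {{ℚ.positive 0<p}}}} , ℚ.*-inverseʳ p {{p≢0}}
  where p≢0 = ℚ.pos⇒nonZero p {{ℚ.positive 0<p}}

pos-cancel-≡ : ∀ {p q} → 0ℚ ℚ.< p → p ℚ.* q ≡ 0ℚ → q ≡ 0ℚ
pos-cancel-≡ {p} {q} 0<p pq≡0 with p⁻¹ , _ , e ← pos⇒inverse 0<p = begin
  q                    ≡⟨ sym (ℚ.*-identityˡ q) ⟩
  1ℚ ℚ.* q             ≡⟨ cong (ℚ._* q) (sym e) ⟩
  p ℚ.* p⁻¹ ℚ.* q      ≡⟨ ℚS.solve 3 (λ p i q → p :* i :* q := i :* (p :* q)) refl p p⁻¹ q ⟩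
  p⁻¹ ℚ.* (p ℚ.* q)    ≡⟨ cong (p⁻¹ ℚ.*_) pq≡0 ⟩
  p⁻¹ ℚ.* 0ℚ           ≡⟨ ℚ.*-zeroʳ p⁻¹ ⟩
  0ℚ                   ∎
  where
  open ≡-Reasoning
  open ℚS

sum≡0⇒≡0 : ∀ {p q} → 0ℚ ℚ.≤ p → 0ℚ ℚ.≤ q → p ℚ.+ q ≡ 0ℚ → p ≡ 0ℚ × q ≡ 0ℚ
sum≡0⇒≡0 {p} {q} 0≤p 0≤q e =
    ℚ.≤-antisym (subst₂ ℚ._≤_ (ℚ.+-identityʳ p) e (ℚ.+-monoʳ-≤ p 0≤q)) 0≤p
  , ℚ.≤-antisym (subst₂ ℚ._≤_ (ℚ.+-identityˡ q) e (ℚ.+-monoˡ-≤ q 0≤p)) 0≤q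

weighted≡0⇒≡0 : ∀ {a b p q} → 0ℚ ℚ.< a → 0ℚ ℚ.< b → 0ℚ ℚ.≤ p → 0ℚ ℚ.≤ q →
                a ℚ.* p ℚ.+ b ℚ.* q ≡ 0ℚ → p ≡ 0ℚ × q ≡ 0ℚ
weighted≡0⇒≡0 0<a 0<b 0≤p 0≤q e
  with e₁ , e₂ ← sum≡0⇒≡0 (*-nonNeg (ℚ.<⇒≤ 0<a) 0≤p) (*-nonNeg (ℚ.<⇒≤ 0<b) 0≤q) e
  = pos-cancel-≡ 0<a e₁ , pos-cancel-≡ 0<b e₂

-- toℚ normalises by a gcd, so it unfolds into large terms; ι is a copy that does not unfold.
opaque
  ι : ℕ → ℚ
  ι = toℚ

  ι≡toℚ : ∀ n → ι n ≡ toℚ n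
  ι≡toℚ n = refl

  ι0≡0 : ι 0 ≡ 0ℚ
  ι0≡0 = refl

  ι1≡1 : ι 1 ≡ 1ℚ
  ι1≡1 = refl

  ι-+ : ∀ m n → ι (m + n) ≡ ι m ℚ.+ ι n
  ι-+ m n = ℚ.toℚᵘ-injective (begin
    ℚ.toℚᵘ (ι (m + n))                        ≈⟨ ℚ.toℚᵘ-fromℚᵘ (ℚᵘ.mkℚᵘ (ℤ.+ (m + n)) 0) ⟩
    ℚᵘ.mkℚᵘ (ℤ.+ (m + n)) 0                       ≈⟨ ℚᵘ.*≡* (cong (λ z → z ℤ.* ℤ.+ 1) (sym (cong₂ ℤ._+_ (ℤ.*-identityʳ (ℤ.+ m)) (ℤ.*-identityʳ (ℤ.+ n))))) ⟩
    ℚᵘ.mkℚᵘ (ℤ.+ m) 0 ℚᵘ.+ ℚᵘ.mkℚᵘ (ℤ.+ n) 0        ≈⟨ ℚᵘ.+-cong (ℚ.toℚᵘ-fromℚᵘ (ℚᵘ.mkℚᵘ (ℤ.+ m) 0)) (ℚ.toℚᵘ-fromℚᵘ (ℚᵘ.mkℚᵘ (ℤ.+ n) 0)) ⟨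
    ℚ.toℚᵘ (ι m) ℚᵘ.+ ℚ.toℚᵘ (ι n)          ≈⟨ ℚ.toℚᵘ-homo-+ (ι m) (ι n) ⟨
    ℚ.toℚᵘ (ι m ℚ.+ ι n)                    ∎)
    where
    open ℚᵘ.≃-Reasoning

  ι-* : ∀ m n → ι (m * n) ≡ ι m ℚ.* ι n
  ι-* zero    n = sym (ℚ.*-zeroˡ (ι n))
  ι-* (suc m) n = begin
    ι (n + m * n)                    ≡⟨ ι-+ n (m * n) ⟩
    ι n ℚ.+ ι (m * n)              ≡⟨ cong (ι n ℚ.+_) (ι-* m n) ⟩
    ι n ℚ.+ ι m ℚ.* ι n          ≡⟨ ℚS.solve 2 (λ m n → n :+ m :* n := (con 1ℚ :+ m) :* n) refl (ι m) (ι n) ⟩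
    (1ℚ ℚ.+ ι m) ℚ.* ι n           ≡⟨ cong (ℚ._* ι n) (sym (ι-+ 1 m)) ⟩
    ι (suc m) ℚ.* ι n              ∎
    where
    open ≡-Reasoning
    open ℚS

  ι-nonNeg : ∀ n → 0ℚ ℚ.≤ ι n
  ι-nonNeg n = ℚ.nonNegative⁻¹ (ι n) {{ℚ.normalize-nonNeg n 1}}

  ι-pos : ∀ {n} → 0 < n → 0ℚ ℚ.< ι n
  ι-pos {suc n} _ = ℚ.positive⁻¹ (ι (suc n)) {{ℚ.normalize-pos (suc n) 1}}

  ι-∸ : ∀ {m n} → n ≤ m → ι (m ∸ n) ≡ ι m ℚ.- ι n
  ι-∸ {m} {n} n≤m = begin
    ι (m ∸ n)                          ≡⟨ ℚS.solve 2 (λ x y → x := x :+ y :- y) refl (ι (m ∸ n)) (ι n) ⟩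
    ι (m ∸ n) ℚ.+ ι n ℚ.- ι n      ≡⟨ cong (ℚ._- ι n) (sym (ι-+ (m ∸ n) n)) ⟩
    ι (m ∸ n + n) ℚ.- ι n            ≡⟨ cong (λ k → ι k ℚ.- ι n) (m∸n+n≡m n≤m) ⟩
    ι m ℚ.- ι n                      ∎
    where
    open ≡-Reasoning
    open ℚS

-- Rays on which a nonnegative functional vanishes

injection⇒≤length : ∀ {A : Set} {k} (f : Fin k → A) → (∀ {i j} → f i ≡ f j → i ≡ j) →
                    ∀ {xs} → (∀ i → f i ∈ xs) → k ≤ length xs
injection⇒≤length {A} f f-inj f∈ = Fin.injective⇒≤ {f = λ i → index (f∈ i)}
  (λ {i} {j} eq → f-inj (index-injective (setoid A) (f∈ i) (f∈ j) eq))

unique⇒lookup-injective : ∀ {A : Set} {xs : List A} → Unique xs →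
                          ∀ {i j} → lookup xs i ≡ lookup xs j → i ≡ j
unique⇒lookup-injective (_  ∷ _)  {zero}  {zero}  _  = refl
unique⇒lookup-injective (x∉ ∷ _)  {zero}  {suc j} eq = contradiction eq (All.lookup x∉ (∈-lookup j))
unique⇒lookup-injective (x∉ ∷ _)  {suc i} {zero}  eq = contradiction (sym eq) (All.lookup x∉ (∈-lookup i))
unique⇒lookup-injective (_  ∷ xs) {suc i} {suc j} eq = cong suc (unique⇒lookup-injective xs eq)

unique-⊆⇒length≤ : ∀ {A : Set} {xs ys : List A} → Unique xs → (∀ {x} → x ∈ xs → x ∈ ys) →
                   length xs ≤ length ys
unique-⊆⇒length≤ {xs = xs} uniq ⊆ =
  injection⇒≤length (lookup xs) (unique⇒lookup-injective uniq) (λ i → ⊆ (∈-lookup i))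

∈⇒length>0 : ∀ {A : Set} {x : A} {xs} → x ∈ xs → 1 ≤ length xs
∈⇒length>0 {xs = _ ∷ _} _ = s≤s z≤n

length-cartesianProductWith : ∀ {A B C : Set} (f : A → B → C) xs ys →
  length (cartesianProductWith f xs ys) ≡ length xs * length ys
length-cartesianProductWith f []       ys = refl
length-cartesianProductWith f (x ∷ xs) ys = trans (length-++ (map (f x) ys))
  (cong₂ _+_ (length-map (f x) ys) (length-cartesianProductWith f xs ys))

length-trichotomy : ∀ j xs →
  length (filter (_<? j) xs) + (length (filter (j <?_) xs) + length (filter (_≟ j) xs)) ≡ length xs
length-trichotomy j [] = refl
length-trichotomy j (x ∷ xs) with <-cmp x j
... | tri< a ¬b ¬c
  rewrite filter-accept (_<? j) {xs = xs} a | filter-reject (_≟ j) {xs = xs} ¬b | filter-reject (j <?_) {xs = xs} ¬c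
  = cong suc (length-trichotomy j xs)
... | tri≈ ¬a b ¬c
  rewrite filter-reject (_<? j) {xs = xs} ¬a | filter-accept (_≟ j) {xs = xs} b | filter-reject (j <?_) {xs = xs} ¬c
  = trans (cong (length (filter (_<? j) xs) +_) (+-suc _ _)) (trans (+-suc _ _) (cong suc (length-trichotomy j xs)))
... | tri> ¬a ¬b c
  rewrite filter-reject (_<? j) {xs = xs} ¬a | filter-reject (_≟ j) {xs = xs} ¬b | filter-accept (j <?_) {xs = xs} c
  = trans (+-suc _ _) (cong suc (length-trichotomy j xs))

length-concatMap-≤ : ∀ {A B : Set} (f : A → List B) n b xs → (∀ x → n * length (f x) ≤ b) →
                     n * length (concatMap f xs) ≤ length xs * b
length-concatMap-≤ f n b []       h = ≤-reflexive (*-zeroʳ n)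
length-concatMap-≤ f n b (x ∷ xs) h
  rewrite length-++ (f x) {concatMap f xs} | *-distribˡ-+ n (length (f x)) (length (concatMap f xs))
  = +-mono-≤ (h x) (length-concatMap-≤ f n b xs h)

-- The n hypotheses add up to n * total ≤ n * b. This avoids singling out a longest row.
length-concatMap-average : ∀ {A B : Set} (f : A → List B) b xs →
  (∀ x → length xs * length (f x) ≤ b) → length (concatMap f xs) ≤ b
length-concatMap-average f b []          h = z≤n
length-concatMap-average f b xs@(_ ∷ ys) h =
  *-cancelˡ-≤ (suc (length ys)) (length-concatMap-≤ f (length xs) b xs h)

least : ∀ {P : ℕ → Set} → Decidable P → ∀ n → P n → ∃[ m ] (m ≤ n × P m × (∀ x → P x → m ≤ x))
least P? zero    p = zero , z≤n , p , λ _ _ → z≤n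
least {P} P? (suc n) p with P? 0
... | yes p₀ = zero , z≤n , p₀ , λ _ _ → z≤n
... | no ¬p₀ with m , m≤n , pm , min ← least (P? ∘ suc) n p = suc m , s≤s m≤n , pm , min′
  where
  min′ : ∀ x → P x → suc m ≤ x
  min′ zero    px = contradiction px ¬p₀
  min′ (suc x) px = s≤s (min x px)

greatest : ∀ {P : ℕ → Set} → Decidable P → ∀ r n → n ≤ r → P n →
           ∃[ m ] (n ≤ m × m ≤ r × P m × (∀ x → x ≤ r → P x → x ≤ m))
greatest P? zero    zero z≤n p = zero , z≤n , z≤n , p , λ _ x≤0 _ → x≤0
greatest {P} P? (suc r) n n≤1+r p with P? (suc r)
... | yes p′ = suc r , n≤1+r , ≤-refl , p′ , λ _ x≤ _ → x≤
... | no ¬p′ =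
  let below = λ x x≤ px → ≤-pred (≤∧≢⇒< x≤ λ x≡ → ¬p′ (subst P x≡ px))
      m , n≤m , m≤r , pm , max = greatest P? r n (below n n≤1+r p) p
  in  m , n≤m , m≤n⇒m≤1+n m≤r , pm , λ x x≤ px → max x (below x x≤ px) px

-- Each ray of such a list has a kink coordinate that vanishes on all later rays.
data Triangular : List Ray → Set where
  []     : Triangular []
  by-mid : ∀ {t ts} → All (λ s → mid s ≢ mid t) ts → Triangular ts → Triangular (t ∷ ts)
  by-end : ∀ {t ts} b → 1 ≤ b → b ≡ left t ⊎ b ≡ right t →
           All (λ s → ¬ (b ≡ left s ⊎ b ≡ right s)) ts → Triangular ts → Triangular (t ∷ ts)

-- The value on a ray of the linear functional with values H j at (ω_j , 0) and Q j at (0 , ω_j),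
-- see `linear-ray`. The coefficient `w t` of H is divided between the two ends, so that each end
-- contributes one height difference.
pairing : (H Q : ℕ → ℚ) → Ray → ℚ
pairing H Q t = ι (wl t) ℚ.* (H (mid t) ℚ.+ Q (left t)) ℚ.+ ι (wr t) ℚ.* (H (mid t) ℚ.+ Q (right t))

module TightRays (r : ℕ) (H Q : ℕ → ℚ) (valid : ∀ t → Ok r t → 0ℚ ℚ.≤ pairing H Q t) where

  ev : Ray → ℚ
  ev = pairing H Q

  excess : ℚ → ℚ → ℕ → ℚ
  excess u σ x = Q x ℚ.- (u ℚ.+ σ ℚ.* ι x)

  -- Subtracting the line from Q at both ends costs `w t` times its value at the middle, by
  -- `balance`. The height h is arbitrary because `inner⇒touches-ends` takes it to be - Q b, on the
  -- graph itself.
  pairing-excess : ∀ u σ h t → Ok r t →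
    ι (wl t) ℚ.* (h ℚ.+ Q (left t)) ℚ.+ ι (wr t) ℚ.* (h ℚ.+ Q (right t)) ≡
    ι (wl t) ℚ.* excess u σ (left t) ℚ.+ ι (wr t) ℚ.* excess u σ (right t)
      ℚ.+ (ι (w t) ℚ.* (h ℚ.+ (u ℚ.+ σ ℚ.* ι (mid t))))
  pairing-excess u σ h t ok = begin
    a ℚ.* (h ℚ.+ Q (left t)) ℚ.+ b ℚ.* (h ℚ.+ Q (right t))
      ≡⟨ ℚS.solve 9 (λ a b h u σ i k p q →
           a :* (h :+ p) :+ b :* (h :+ q) :=
           a :* (p :- (u :+ σ :* i)) :+ b :* (q :- (u :+ σ :* k))
             :+ ((a :+ b) :* (h :+ u) :+ σ :* (a :* i :+ b :* k)))
           refl a b h u σ i k (Q (left t)) (Q (right t)) ⟩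
    rest ℚ.+ ((a ℚ.+ b) ℚ.* (h ℚ.+ u) ℚ.+ σ ℚ.* (a ℚ.* i ℚ.+ b ℚ.* k))
      ≡⟨ cong₂ (λ x y → rest ℚ.+ (x ℚ.* (h ℚ.+ u) ℚ.+ σ ℚ.* y)) (sym (ι-+ (wl t) (wr t))) (sym balanceℚ) ⟩
    rest ℚ.+ (ι (w t) ℚ.* (h ℚ.+ u) ℚ.+ σ ℚ.* (ι (w t) ℚ.* j))
      ≡⟨ cong (rest ℚ.+_) (ℚS.solve 5 (λ w h u σ j → w :* (h :+ u) :+ σ :* (w :* j) := w :* (h :+ (u :+ σ :* j)))
           refl (ι (w t)) h u σ j) ⟩
    rest ℚ.+ ι (w t) ℚ.* (h ℚ.+ (u ℚ.+ σ ℚ.* j)) ∎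
    where
    open ≡-Reasoning
    open ℚS
    a = ι (wl t)
    b = ι (wr t)
    i = ι (left t)
    j = ι (mid t)
    k = ι (right t)
    rest = a ℚ.* excess u σ (left t) ℚ.+ b ℚ.* excess u σ (right t)
    balanceℚ : ι (w t) ℚ.* j ≡ a ℚ.* i ℚ.+ b ℚ.* k
    balanceℚ = begin
      ι (w t) ℚ.* j                                  ≡⟨ sym (ι-* (w t) (mid t)) ⟩
      ι (w t * mid t)                                ≡⟨ cong ι (balance t ok) ⟩
      ι (wl t * left t + wr t * right t)             ≡⟨ ι-+ (wl t * left t) (wr t * right t) ⟩
      ι (wl t * left t) ℚ.+ ι (wr t * right t)     ≡⟨ cong₂ ℚ._+_ (ι-* (wl t) (left t)) (ι-* (wr t) (right t)) ⟩
      a ℚ.* i ℚ.+ b ℚ.* k                              ∎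

  +-zeroʳ : ∀ x c {y} → y ≡ 0ℚ → x ℚ.+ c ℚ.* y ≡ x
  +-zeroʳ x c refl = trans (cong (x ℚ.+_) (ℚ.*-zeroʳ c)) (ℚ.+-identityʳ x)

  +-zeroˡ : ∀ c {y} → y ≡ 0ℚ → ∀ x → c ℚ.* y ℚ.+ x ≡ x
  +-zeroˡ c refl x = trans (cong (ℚ._+ x) (ℚ.*-zeroʳ c)) (ℚ.+-identityˡ x)

  dg-weights : ∀ y → ι 1 ℚ.* y ℚ.+ ι 0 ℚ.* y ≡ y
  dg-weights y = trans (cong₂ (λ a b → a ℚ.* y ℚ.+ b ℚ.* y) ι1≡1 ι0≡0)
    (ℚS.solve 1 (λ y → con 1ℚ :* y :+ con 0ℚ :* y := y) refl y)
    where open ℚS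

  ev-dg : ∀ j → ev (dg j) ≡ H j ℚ.+ Q j
  ev-dg j = dg-weights (H j ℚ.+ Q j)

  ev-excess : ∀ u σ t → Ok r t → H (mid t) ℚ.+ (u ℚ.+ σ ℚ.* ι (mid t)) ≡ 0ℚ →
    ev t ≡ ι (wl t) ℚ.* excess u σ (left t) ℚ.+ ι (wr t) ℚ.* excess u σ (right t)
  ev-excess u σ t ok thr = trans (pairing-excess u σ (H (mid t)) t ok) (+-zeroʳ _ (ι (w t)) thr)

  -- Such a line exists only when some tight chord has j strictly between its ends; a tight `dg j`
  -- alone fixes no slope.
  record Line (j : ℕ) : Set where
    field
      u σ      : ℚ
      support  : ∀ x → x ≤ r → 0ℚ ℚ.≤ excess u σ x
      through  : H j ℚ.+ (u ℚ.+ σ ℚ.* ι j) ≡ 0ℚ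
      lo hi    : ℕ
      lo<j     : lo < j
      j<hi     : j < hi
      hi≤r     : hi ≤ r
      touch-lo : excess u σ lo ≡ 0ℚ
      touch-hi : excess u σ hi ≡ 0ℚ
      lo-min   : ∀ x → excess u σ x ≡ 0ℚ → lo ≤ x
      hi-max   : ∀ x → x ≤ r → excess u σ x ≡ 0ℚ → x ≤ hi

    touch : ℕ → Set
    touch x = excess u σ x ≡ 0ℚ

  open Line

  opaque
    touch? : ∀ {j} (ln : Line j) → Decidable (touch ln)
    touch? ln x = excess (u ln) (σ ln) x ℚ.≟ 0ℚ

  Chord : ℕ → Set
  Chord j = ∃[ i ] ∃[ k ] (Ok r (tr i j k) × ev (tr i j k) ≡ 0ℚ)

  -- The line is drawn through the graph points at i and k. With both excesses zero, tightness of
  -- the chord leaves exactly the condition `through`.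
  chord⇒line : ∀ {j} → Chord j → Line j
  chord⇒line {j} (i , k , ok@(i<j , j<k , k≤r) , tight) = record
    { u = u₀ ; σ = σ₀ ; support = supp ; through = thr
    ; lo = proj₁ lo′ ; hi = proj₁ hi′
    ; lo<j = ≤-<-trans (proj₁ (proj₂ lo′)) i<j
    ; j<hi = <-≤-trans j<k (proj₁ (proj₂ hi′))
    ; hi≤r = proj₁ (proj₂ (proj₂ hi′))
    ; touch-lo = proj₁ (proj₂ (proj₂ lo′))
    ; touch-hi = proj₁ (proj₂ (proj₂ (proj₂ hi′)))
    ; lo-min = proj₂ (proj₂ (proj₂ lo′))
    ; hi-max = proj₂ (proj₂ (proj₂ (proj₂ hi′)))
    }
    where
    open ≡-Reasoning
    open ℚS
    i<k : i < k
    i<k = <-trans i<j j<k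
    inv = pos⇒inverse (ι-pos (m<n⇒0<n∸m i<k))
    δ⁻¹ σ₀ u₀ : ℚ
    δ⁻¹ = proj₁ inv
    σ₀ = (Q k ℚ.- Q i) ℚ.* δ⁻¹
    u₀ = Q i ℚ.- σ₀ ℚ.* ι i
    touch-i : excess u₀ σ₀ i ≡ 0ℚ
    touch-i = ℚS.solve 2 (λ q s → q :- (q :- s :+ s) := con 0ℚ) refl (Q i) (σ₀ ℚ.* ι i)
    touch-k : excess u₀ σ₀ k ≡ 0ℚ
    touch-k = begin
      excess u₀ σ₀ k
        ≡⟨ ℚS.solve 5 (λ p q d i k → q :- (p :- (q :- p) :* d :* i :+ (q :- p) :* d :* k)
             := (q :- p) :- (q :- p) :* ((k :- i) :* d)) refl (Q i) (Q k) δ⁻¹ (ι i) (ι k) ⟩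
      Q k ℚ.- Q i ℚ.- (Q k ℚ.- Q i) ℚ.* ((ι k ℚ.- ι i) ℚ.* δ⁻¹)
        ≡⟨ cong (λ x → Q k ℚ.- Q i ℚ.- (Q k ℚ.- Q i) ℚ.* x)
             (trans (cong (ℚ._* δ⁻¹) (sym (ι-∸ (<⇒≤ i<k)))) (proj₂ (proj₂ inv))) ⟩
      Q k ℚ.- Q i ℚ.- (Q k ℚ.- Q i) ℚ.* 1ℚ
        ≡⟨ ℚS.solve 1 (λ x → x :- x :* con 1ℚ := con 0ℚ) refl (Q k ℚ.- Q i) ⟩
      0ℚ ∎
    thr : H j ℚ.+ (u₀ ℚ.+ σ₀ ℚ.* ι j) ≡ 0ℚ
    thr = pos-cancel-≡ (ι-pos (w>0 (tr i j k) ok)) (begin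
      ι W ℚ.* y                                    ≡⟨ sym (+-zeroˡ (ι (j ∸ i)) touch-k (ι W ℚ.* y)) ⟩
      ι (j ∸ i) ℚ.* excess u₀ σ₀ k ℚ.+ ι W ℚ.* y
        ≡⟨ cong (ℚ._+ ι W ℚ.* y) (sym (+-zeroˡ (ι (k ∸ j)) touch-i (ι (j ∸ i) ℚ.* excess u₀ σ₀ k))) ⟩
      ι (k ∸ j) ℚ.* excess u₀ σ₀ i ℚ.+ ι (j ∸ i) ℚ.* excess u₀ σ₀ k ℚ.+ ι W ℚ.* y
        ≡⟨ sym (pairing-excess u₀ σ₀ (H j) (tr i j k) ok) ⟩
      ev (tr i j k)                                ≡⟨ tight ⟩
      0ℚ                                           ∎)
      where
      W = w (tr i j k)
      y = H j ℚ.+ (u₀ ℚ.+ σ₀ ℚ.* ι j)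
    -- For x < j, the pairing of `tr x j k` is k ∸ j times the excess at x, since k touches and the
    -- line passes through (j , - H j); validity gives the sign. For x > j the end i takes the place
    -- of k, and for x = j the ray is `dg j`.
    supp : ∀ x → x ≤ r → 0ℚ ℚ.≤ excess u₀ σ₀ x
    supp x x≤r with <-cmp x j
    ... | tri< x<j _ _ = pos-cancel-≤ (ι-pos (m<n⇒0<n∸m j<k))
      (subst (0ℚ ℚ.≤_) (trans (ev-excess u₀ σ₀ (tr x j k) ok′ thr) (+-zeroʳ (ι (k ∸ j) ℚ.* excess u₀ σ₀ x) (ι (j ∸ x)) touch-k)) (valid _ ok′))
      where ok′ = x<j , j<k , k≤r
    ... | tri≈ _ refl _ = subst (0ℚ ℚ.≤_)
      (trans (ev-excess u₀ σ₀ (dg x) ok′ thr)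
        (dg-weights (excess u₀ σ₀ x)))
      (valid (dg x) ok′)
      where ok′ = ≤-trans (s≤s z≤n) i<j , x≤r
    ... | tri> _ _ j<x = pos-cancel-≤ (ι-pos (m<n⇒0<n∸m i<j))
      (subst (0ℚ ℚ.≤_) (trans (ev-excess u₀ σ₀ (tr i j x) ok′ thr)
        (+-zeroˡ (ι (x ∸ j)) touch-i (ι (j ∸ i) ℚ.* excess u₀ σ₀ x))) (valid _ ok′))
      where ok′ = i<j , j<x , x≤r
    lo′ = least (λ x → excess u₀ σ₀ x ℚ.≟ 0ℚ) i touch-i
    hi′ = greatest (λ x → excess u₀ σ₀ x ℚ.≟ 0ℚ) r k k≤r touch-k

  module _ {j : ℕ} (ln : Line j) where

    touching⇒tight : ∀ t → Ok r t → H (mid t) ℚ.+ (u ln ℚ.+ σ ln ℚ.* ι (mid t)) ≡ 0ℚ →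
                     touch ln (left t) → touch ln (right t) → ev t ≡ 0ℚ
    touching⇒tight t ok thr ei ek = trans (ev-excess (u ln) (σ ln) t ok thr)
      (trans (+-zeroʳ (ι (wl t) ℚ.* excess (u ln) (σ ln) (left t)) (ι (wr t)) ek) (trans (cong (ι (wl t) ℚ.*_) ei) (ℚ.*-zeroʳ (ι (wl t)))))

    -- A zero sum of nonnegative excesses with positive weights. Hence the line built from one tight
    -- chord over j carries all of them.
    tight⇒touching : ∀ {i k} → Ok r (tr i j k) → ev (tr i j k) ≡ 0ℚ → touch ln i × touch ln k
    tight⇒touching {i} {k} ok@(i<j , j<k , k≤r) tight =
      weighted≡0⇒≡0 (ι-pos (m<n⇒0<n∸m j<k)) (ι-pos (m<n⇒0<n∸m i<j))
        (support ln i (<⇒≤ (<-trans i<j (<-≤-trans j<k k≤r)))) (support ln k k≤r)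
        (trans (sym (ev-excess (u ln) (σ ln) (tr i j k) ok (through ln))) tight)

    dg-tight⇒touch : ∀ {b} → H b ℚ.+ (u ln ℚ.+ σ ln ℚ.* ι b) ≡ 0ℚ → ev (dg b) ≡ 0ℚ → touch ln b
    dg-tight⇒touch {b} thr tight = begin
      Q b ℚ.- ℓ                                                     ≡⟨ ℚS.solve 3 (λ h q l → q :- l := h :+ q :- (h :+ l)) refl (H b) (Q b) ℓ ⟩
      H b ℚ.+ Q b ℚ.- (H b ℚ.+ ℓ)                                   ≡⟨ cong₂ ℚ._-_ (trans (sym (ev-dg b)) tight) thr ⟩
      0ℚ                                                            ∎
      where
      open ≡-Reasoning
      open ℚS
      ℓ = u ln ℚ.+ σ ln ℚ.* ι b

    dg-tight∧touch⇒through : ∀ {b} → touch ln b → ev (dg b) ≡ 0ℚ → H b ℚ.+ (u ln ℚ.+ σ ln ℚ.* ι b) ≡ 0ℚ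
    dg-tight∧touch⇒through {b} tch tight = begin
      H b ℚ.+ ℓ                                                     ≡⟨ ℚS.solve 3 (λ h q l → h :+ l := h :+ q :- (q :- l)) refl (H b) (Q b) ℓ ⟩
      H b ℚ.+ Q b ℚ.- (Q b ℚ.- ℓ)                                   ≡⟨ cong₂ ℚ._-_ (trans (sym (ev-dg b)) tight) tch ⟩
      0ℚ                                                            ∎
      where
      open ≡-Reasoning
      open ℚS
      ℓ = u ln ℚ.+ σ ln ℚ.* ι b

    InnerOf : ℕ → Set
    InnerOf b = lo ln < b × b < hi ln × touch ln b

    innerOf? : Decidable InnerOf
    innerOf? b = (lo ln <? b) ×-dec ((b <? hi ln) ×-dec touch? ln b)

    -- Measure the height of the chord of `ln` over b above the graph point at b. With respect to
    -- `ln` it is zero; with respect to `ln′` it is a positive combination of the excesses at the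
    -- two ends of that chord, so both of these vanish.
    inner⇒touches-ends : ∀ {b} → InnerOf b → ∀ {j′} (ln′ : Line j′) → touch ln′ b →
                         touch ln′ (lo ln) × touch ln′ (hi ln)
    inner⇒touches-ends {b} (lo<b , b<hi , tch) ln′ tch′ =
      weighted≡0⇒≡0 (ι-pos (m<n⇒0<n∸m b<hi)) (ι-pos (m<n⇒0<n∸m lo<b))
        (support ln′ (lo ln) (<⇒≤ (<-trans lo<b (<-≤-trans b<hi (hi≤r ln))))) (support ln′ (hi ln) (hi≤r ln))
        (begin
          a ℚ.* excess (u ln′) (σ ln′) (lo ln) ℚ.+ c ℚ.* excess (u ln′) (σ ln′) (hi ln)
            ≡⟨ sym (+-zeroʳ _ (ι (w t)) (neg-touch ln′ tch′)) ⟩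
          a ℚ.* excess (u ln′) (σ ln′) (lo ln) ℚ.+ c ℚ.* excess (u ln′) (σ ln′) (hi ln)
            ℚ.+ ι (w t) ℚ.* (ℚ.- Q b ℚ.+ (u ln′ ℚ.+ σ ln′ ℚ.* ι b))
            ≡⟨ sym (pairing-excess (u ln′) (σ ln′) (ℚ.- Q b) t ok) ⟩
          a ℚ.* (ℚ.- Q b ℚ.+ Q (lo ln)) ℚ.+ c ℚ.* (ℚ.- Q b ℚ.+ Q (hi ln))
            ≡⟨ pairing-excess (u ln) (σ ln) (ℚ.- Q b) t ok ⟩
          a ℚ.* excess (u ln) (σ ln) (lo ln) ℚ.+ c ℚ.* excess (u ln) (σ ln) (hi ln)
            ℚ.+ ι (w t) ℚ.* (ℚ.- Q b ℚ.+ (u ln ℚ.+ σ ln ℚ.* ι b))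
            ≡⟨ +-zeroʳ _ (ι (w t)) (neg-touch ln tch) ⟩
          a ℚ.* excess (u ln) (σ ln) (lo ln) ℚ.+ c ℚ.* excess (u ln) (σ ln) (hi ln)
            ≡⟨ +-zeroʳ _ c (touch-hi ln) ⟩
          a ℚ.* excess (u ln) (σ ln) (lo ln)
            ≡⟨ trans (cong (a ℚ.*_) (touch-lo ln)) (ℚ.*-zeroʳ a) ⟩
          0ℚ ∎)
      where
      open ≡-Reasoning
      open ℚS
      t = tr (lo ln) b (hi ln)
      ok : Ok r t
      ok = lo<b , b<hi , hi≤r ln
      a = ι (hi ln ∸ b)
      c = ι (b ∸ lo ln)
      neg-touch : ∀ {j} (ln : Line j) → touch ln b → ℚ.- Q b ℚ.+ (u ln ℚ.+ σ ln ℚ.* ι b) ≡ 0ℚ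
      neg-touch ln tch = trans (ℚS.solve 2 (λ q l → :- q :+ l := :- (q :- l)) refl (Q b) (u ln ℚ.+ σ ln ℚ.* ι b)) (cong ℚ.-_ tch)

  opaque
    chord? : ∀ j → Dec (Chord j)
    chord? j = map′
      (λ { (i , _ , k , _ , p) → i , k , p })
      (λ { (i , k , p@((i<j , j<k , k≤r) , _)) → i , <-trans i<j (<-≤-trans j<k (m≤n⇒m≤1+n k≤r)) , k , s≤s k≤r , p })
      (anyUpTo? (λ i → anyUpTo? (λ k →
        ((i <? j) ×-dec ((j <? k) ×-dec (k ≤? r))) ×-dec (ev (tr i j k) ℚ.≟ 0ℚ)) (suc r)) (suc r))

    line? : ∀ j → Dec (Line j)
    line? j = map′ chord⇒line
      (λ ln → lo ln , hi ln , (lo<j ln , j<hi ln , hi≤r ln) ,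
        touching⇒tight ln (tr (lo ln) j (hi ln)) (lo<j ln , j<hi ln , hi≤r ln) (through ln) (touch-lo ln) (touch-hi ln))
      (chord? j)

  -- Inner points over j refer to the one line that `line? j` returns, so a bounded search over j
  -- decides `Inner`.
  InnerAt : ∀ {j} → Dec (Line j) → ℕ → Set
  InnerAt (yes ln) b = InnerOf ln b
  InnerAt (no _)   b = ⊥

  innerAt? : ∀ {j} (d : Dec (Line j)) → Decidable (InnerAt d)
  innerAt? (yes ln) b = innerOf? ln b
  innerAt? (no _)   b = no λ ()

  Inner : ℕ → Set
  Inner b = ∃[ j ] InnerAt (line? j) b

  opaque
    inner? : Decidable Inner
    inner? b = map′ (λ { (j , _ , p) → j , p }) (λ { (j , p) → j , bounded (line? j) p , p })
      (anyUpTo? (λ j → innerAt? (line? j) b) (suc r))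
      where
      bounded : ∀ {j} (d : Dec (Line j)) → InnerAt d b → j < suc r
      bounded (yes ln) _ = <-trans (j<hi ln) (s≤s (hi≤r ln))

  inner⇒line : ∀ {b} → Inner b → ∃[ j ] Σ[ ln ∈ Line j ] InnerOf ln b
  inner⇒line (j , p) with line? j
  ... | yes ln = j , ln , p

  -- Otherwise `ln` would also touch at both ends of the line in which b is inner, one of them
  -- beyond its own first or last touching point.
  inner≢end : ∀ {b} → Inner b → ∀ {j} (ln : Line j) → ¬ (b ≡ lo ln ⊎ b ≡ hi ln)
  inner≢end inn ln eq with inner⇒line inn
  inner≢end inn ln (inj₁ refl) | _ , ln′ , p@(lo<b , _) =
    <⇒≱ lo<b (lo-min ln _ (proj₁ (inner⇒touches-ends ln′ p ln (touch-lo ln))))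
  inner≢end inn ln (inj₂ refl) | _ , ln′ , p@(_ , b<hi , _) =
    <⇒≱ b<hi (hi-max ln _ (hi≤r ln′) (proj₂ (inner⇒touches-ends ln′ p ln (touch-hi ln))))

  -- Tightness of `dg b` says Q b = - H b, so a line touching at b also satisfies `through` at b,
  -- and its widest chord is tight over b. Thus a middle without a line is never an inner point.
  inner∧dg-tight⇒line : ∀ {b} → Inner b → ev (dg b) ≡ 0ℚ → Line b
  inner∧dg-tight⇒line {b} inn tight with _ , ln , lo<b , b<hi , tch ← inner⇒line inn =
    chord⇒line (lo ln , hi ln , ok ,
      touching⇒tight ln (tr (lo ln) b (hi ln)) ok (dg-tight∧touch⇒through ln tch tight) (touch-lo ln) (touch-hi ln))
    where ok = lo<b , b<hi , hi≤r ln

  -- A triangular family of tight rays.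

  Middle : ℕ → Set
  Middle j = (1 ≤ j × j ≤ r) × (ev (dg j) ≡ 0ℚ ⊎ Chord j)

  opaque
    middle? : Decidable Middle
    middle? j = ((1 ≤? j) ×-dec (j ≤? r)) ×-dec ((ev (dg j) ℚ.≟ 0ℚ) ⊎-dec chord? j)

  middles inners : List ℕ
  middles = filter middle? (upTo (suc r))
  inners  = filter inner? (upTo (suc r))

  Tight : Ray → Set
  Tight t = Ok r t × ev t ≡ 0ℚ

  -- The invariant behind triangularity: a new inner point outside bs is an end of no ray collected
  -- so far.
  InnerEndsIn : List ℕ → Ray → Set
  InnerEndsIn bs t = ∀ b → Inner b → b ≡ left t ⊎ b ≡ right t → b ∈ bs

  -- The widest chord is chosen because extreme touching points are not inner; a shorter chord could
  -- end at an inner point.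
  middle-ray : ∀ {j} → Middle j → ∃[ t ] (mid t ≡ j × Tight t × InnerEndsIn [] t)
  middle-ray {j} (bounds , tight) with line? j
  ... | yes ln = tr (lo ln) j (hi ln) , refl ,
      (ok , touching⇒tight ln (tr (lo ln) j (hi ln)) ok (through ln) (touch-lo ln) (touch-hi ln)) ,
      λ b inn e → contradiction e (inner≢end inn ln)
    where ok = lo<j ln , j<hi ln , hi≤r ln
  middle-ray {j} (bounds , inj₁ tight) | no ¬ln = dg j , refl , (bounds , tight) ,
    λ { b inn (inj₁ refl) → contradiction (inner∧dg-tight⇒line inn tight) ¬ln
      ; b inn (inj₂ refl) → contradiction (inner∧dg-tight⇒line inn tight) ¬ln }
  middle-ray {j} (bounds , inj₂ chord) | no ¬ln = contradiction (chord⇒line chord) ¬ln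

  -- The other end is the extreme touching point on the far side of j, so b is the only inner end.
  -- If b = j, then `dg b` is tight: the line both touches the graph at b and passes through (b , -
  -- H b).
  inner-ray : ∀ {b} → Inner b → ∃[ t ] ((b ≡ left t ⊎ b ≡ right t) × Tight t × InnerEndsIn (b ∷ []) t)
  inner-ray {b} inn with j , ln , lo<b , b<hi , tch ← inner⇒line inn | <-cmp b j
  ... | tri< b<j _ _ = tr b j (hi ln) , inj₁ refl ,
      (ok , touching⇒tight ln (tr b j (hi ln)) ok (through ln) tch (touch-hi ln)) ,
      λ { _ _ (inj₁ refl) → here refl ; _ inn′ (inj₂ e) → contradiction (inj₂ e) (inner≢end inn′ ln) }
    where ok = b<j , j<hi ln , hi≤r ln
  ... | tri≈ _ refl _ = dg b , inj₁ refl , (ok , touching⇒tight ln (dg b) ok (through ln) tch tch) ,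
      λ { _ _ (inj₁ refl) → here refl ; _ _ (inj₂ refl) → here refl }
    where ok = ≤-<-trans z≤n lo<b , <⇒≤ (<-≤-trans b<hi (hi≤r ln))
  ... | tri> _ _ j<b = tr (lo ln) j b , inj₂ refl ,
      (ok , touching⇒tight ln (tr (lo ln) j b) ok (through ln) (touch-lo ln) tch) ,
      λ { _ inn′ (inj₁ e) → contradiction (inj₁ e) (inner≢end inn′ ln) ; _ _ (inj₂ refl) → here refl }
    where ok = lo<j ln , j<b , <⇒≤ (<-≤-trans b<hi (hi≤r ln))

  middle-rays : ∀ {js} → Unique js → All Middle js →
    ∃[ ts ] (length ts ≡ length js × Triangular ts × All Tight ts
             × All (InnerEndsIn []) ts × All (λ t → mid t ∈ js) ts)
  middle-rays []        []       = [] , refl , [] , [] , [] , []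
  middle-rays (j∉ ∷ us) (p ∷ ps)
    with t , refl , tight , ends ← middle-ray p
       | ts , len , tri , tights , endss , mids ← middle-rays us ps =
    t ∷ ts , cong suc len ,
    by-mid (All.map (λ m∈ e → All.lookup j∉ m∈ (sym e)) mids) tri ,
    tight ∷ tights , ends ∷ endss , here refl ∷ All.map there mids

  -- The rays of inner points stand before the widest chords, with which they may share middles;
  -- only their ends at inner points set them apart.
  inner-rays : ∀ {bs} → Unique bs → All Inner bs → ∀ {ts₀} → Triangular ts₀ → All Tight ts₀ →
    All (InnerEndsIn []) ts₀ →
    ∃[ ts ] (length ts ≡ length bs + length ts₀ × Triangular ts × All Tight ts × All (InnerEndsIn bs) ts)
  inner-rays []        []       {ts₀} tri tights ends = ts₀ , refl , tri , tights , ends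
  inner-rays {b ∷ bs} (b∉ ∷ us) (p ∷ ps) tri₀ tights₀ ends₀
    with t , b∈t , tight , ends ← inner-ray p
       | ts , len , tri , tights , endss ← inner-rays us ps tri₀ tights₀ ends₀ =
    t ∷ ts , cong suc len ,
    by-end b (inner>0 p) b∈t (All.map (λ h e → All.lookup b∉ (h b p e) refl) endss) tri ,
    tight ∷ tights ,
    (λ c inn e → weaken (ends c inn e)) ∷ All.map (λ h c inn e → there (h c inn e)) endss
    where
    weaken : ∀ {c} → c ∈ b ∷ [] → c ∈ b ∷ bs
    weaken (here e) = here e
    inner>0 : ∀ {b} → Inner b → 1 ≤ b
    inner>0 inn with _ , _ , lo<b , _ ← inner⇒line inn = ≤-<-trans z≤n lo<b

  independent-rays : ∃[ ts ] (length ts ≡ length inners + length middles × Triangular ts × All Tight ts)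
  independent-rays
    with ts₀ , len₀ , tri₀ , tights₀ , ends₀ , _ ← middle-rays
           (filter⁺ middle? (upTo⁺ (suc r))) (All.tabulate (λ m → proj₂ (∈-filter⁻ middle? {xs = upTo (suc r)} m)))
    with ts , len , tri , tights , _ ← inner-rays
           (filter⁺ inner? (upTo⁺ (suc r))) (All.tabulate (λ m → proj₂ (∈-filter⁻ inner? {xs = upTo (suc r)} m)))
           tri₀ tights₀ ends₀
    = ts , trans len (cong (length inners +_) len₀) , tri , tights

  -- Counting the tight rays.

  touching : ∀ {j} → Line j → List ℕ
  touching ln = filter (touch? ln) (upTo (suc r))

  ∈-touching : ∀ {j} (ln : Line j) {x} → x ≤ r → touch ln x → x ∈ touching ln
  ∈-touching ln x≤r tch = ∈-filter⁺ (touch? ln) (∈-upTo⁺ (s≤s x≤r)) tch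

  length-touching : ∀ {j} (ln : Line j) → (∀ {b} → InnerOf ln b → Inner b) →
                    length (touching ln) ≤ 2 + length inners
  length-touching ln inn = unique-⊆⇒length≤ {ys = lo ln ∷ hi ln ∷ inners}
    (filter⁺ (touch? ln) (upTo⁺ (suc r))) sub
    where
    sub : ∀ {x} → x ∈ touching ln → x ∈ lo ln ∷ hi ln ∷ inners
    sub {x} x∈ with x∈up , tch ← ∈-filter⁻ (touch? ln) {xs = upTo (suc r)} x∈ | x ≟ lo ln | x ≟ hi ln
    ... | yes e | _     = here e
    ... | no _  | yes e = there (here e)
    ... | no ≢lo | no ≢hi = there (there (∈-filter⁺ inner? x∈up (inn
          ( ≤∧≢⇒< (lo-min ln x tch) (≢lo ∘ sym)
          , ≤∧≢⇒< (hi-max ln x (≤-pred (∈-upTo⁻ x∈up)) tch) ≢hi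
          , tch ))))

  -- The possible ray `dg j` is listed through a filter of the touching points, so that its number,
  -- 0 or 1, is the third class in `length-trichotomy`.
  rowOf : ∀ j → Dec (Line j) → List Ray
  rowOf j (yes ln) =
    cartesianProductWith (λ i k → tr i j k) (filter (_<? j) (touching ln)) (filter (j <?_) (touching ln))
    ++ map dg (filter (_≟ j) (touching ln))
  rowOf j (no _)   = dg j ∷ []

  row : ℕ → List Ray
  row j = rowOf j (line? j)

  tightRays : List Ray
  tightRays = concatMap row middles

  tight∈row : ∀ t (d : Dec (Line (mid t))) → Tight t → t ∈ rowOf (mid t) d
  tight∈row (dg j) (no _)   _ = here refl
  tight∈row (dg j) (yes ln) ((1≤j , j≤r) , tight) =
        ∈-++⁺ʳ (cartesianProductWith (λ i k → tr i j k) (filter (_<? j) (touching ln)) (filter (j <?_) (touching ln)))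
        (∈-map⁺ dg (∈-filter⁺ (_≟ j) (∈-touching ln j≤r (dg-tight⇒touch ln (through ln) tight)) refl))
  tight∈row (tr i j k) (no ¬ln) (ok , tight) = contradiction (chord⇒line (i , k , ok , tight)) ¬ln
  tight∈row (tr i j k) (yes ln) (ok@(i<j , j<k , k≤r) , tight) =
    let ti , tk = tight⇒touching ln ok tight in
        ∈-++⁺ˡ (∈-cartesianProductWith⁺ (λ i k → tr i j k)
        (∈-filter⁺ (_<? j) (∈-touching ln (<⇒≤ (<-trans i<j (<-≤-trans j<k k≤r))) ti) i<j)
        (∈-filter⁺ (j <?_) (∈-touching ln k≤r tk) j<k))

  tight⇒middle : ∀ t → Tight t → Middle (mid t)
  tight⇒middle (dg j) (bounds , tight) = bounds , inj₁ tight
  tight⇒middle (tr i j k) (ok@(i<j , j<k , k≤r) , tight) =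
    (≤-<-trans z≤n i<j , <⇒≤ (<-≤-trans j<k k≤r)) , inj₂ (i , k , ok , tight)

  tight∈tightRays : ∀ t → Tight t → t ∈ tightRays
  tight∈tightRays t tight = ∈-concatMap⁺ row (Any.map (λ { refl → tight∈row t (line? (mid t)) tight })
    (∈-filter⁺ middle? (∈-upTo⁺ (s≤s (proj₂ (proj₁ mdl)))) mdl))
    where mdl = tight⇒middle t tight

  -- With δ touching points at j itself, x z + δ ≤ x (z + δ) because x ≥ 1, and the sum x + z + δ is
  -- the number of touching points. A row without a line holds one ray and takes x = z = 1.
  length-row : ∀ j (d : Dec (Line j)) → (∀ {b} → InnerAt d b → Inner b) →
               ∃[ x ] ∃[ z ] (length (rowOf j d) ≤ x * z × x + z ≤ 2 + length inners)
  length-row j (no _)   inn = 1 , 1 , ≤-refl , s≤s (s≤s z≤n)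
  length-row j (yes ln) inn = x , z + δ , bound ,
    subst (_≤ 2 + length inners) (sym (length-trichotomy j (touching ln))) (length-touching ln inn)
    where
    x = length (filter (_<? j) (touching ln))
    z = length (filter (j <?_) (touching ln))
    δ = length (filter (_≟ j) (touching ln))
    x>0 : 1 ≤ x
    x>0 = ∈⇒length>0 (∈-filter⁺ (_<? j)
      (∈-touching ln (<⇒≤ (<-trans (lo<j ln) (<-≤-trans (j<hi ln) (hi≤r ln)))) (touch-lo ln)) (lo<j ln))
    bound : length (rowOf j (yes ln)) ≤ x * (z + δ)
    bound = begin
      length (rowOf j (yes ln))
        ≡⟨ length-++ (cartesianProductWith (λ i k → tr i j k) (filter (_<? j) (touching ln)) (filter (j <?_) (touching ln))) ⟩
      length (cartesianProductWith (λ i k → tr i j k) (filter (_<? j) (touching ln)) (filter (j <?_) (touching ln)))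
        + length (map dg (filter (_≟ j) (touching ln)))
        ≡⟨ cong₂ _+_ (length-cartesianProductWith _ (filter (_<? j) (touching ln)) (filter (j <?_) (touching ln)))
             (length-map dg (filter (_≟ j) (touching ln))) ⟩
      x * z + δ         ≡⟨ cong (x * z +_) (sym (+-identityʳ δ)) ⟩
      x * z + 1 * δ     ≤⟨ +-monoʳ-≤ (x * z) (*-monoˡ-≤ δ x>0) ⟩
      x * z + x * δ     ≡⟨ sym (*-distribˡ-+ x z δ) ⟩
      x * (z + δ)       ∎
      where open ≤-Reasoning

  length-tightRays : ∀ d → length inners + length middles ≤ d + 1 →
    length tightRays ≤ ((d + 3) / 3) * ((d + 4) / 3) * ((d + 5) / 3)
  length-tightRays d h = length-concatMap-average row _ middles rows
    where
    n = length middles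
    rows : ∀ j → n * length (row j) ≤ ((d + 3) / 3) * ((d + 4) / 3) * ((d + 5) / 3)
    rows j with x , z , len , sum ← length-row j (line? j) (λ p → j , p) = begin
      n * length (row j) ≤⟨ *-monoʳ-≤ n len ⟩
      n * (x * z)        ≡⟨ sym (*-assoc n x z) ⟩
      n * x * z          ≤⟨ xyz≤thirds d n x z sum′ ⟩
      ((d + 3) / 3) * ((d + 4) / 3) * ((d + 5) / 3) ∎
      where
      open ≤-Reasoning
      sum′ : n + x + z ≤ d + 3
      sum′ = begin
        n + x + z                   ≡⟨ +-assoc n x z ⟩
        n + (x + z)                 ≤⟨ +-monoʳ-≤ n sum ⟩
        n + (2 + length inners)     ≡⟨ +-comm n (2 + length inners) ⟩
        2 + (length inners + n)     ≤⟨ +-monoʳ-≤ 2 h ⟩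
        2 + (d + 1)                 ≡⟨ +-comm 2 (d + 1) ⟩
        d + 1 + 2                   ≡⟨ +-assoc d 1 2 ⟩
        d + 3                       ∎

-- Linear functionals and independence

opaque
  unfolding ι
  -- The denominator is at least 1, so the absolute value of the numerator is already a bound; the
  -- successor makes it positive, hence invertible.
  archimedean : ∀ p → ∃[ n ] (0 < n × p ℚ.≤ ι n)
  archimedean p@(ℚ.mkℚ i d _) = suc ℤ.∣ i ∣ , s≤s z≤n , ℚ.toℚᵘ-cancel-≤ (begin
    ℚᵘ.mkℚᵘ i d                        ≤⟨ ℚᵘ.*≤* (bound i) ⟩
    ℚᵘ.mkℚᵘ (ℤ.+ suc ℤ.∣ i ∣) 0          ≃⟨ ℚ.toℚᵘ-fromℚᵘ (ℚᵘ.mkℚᵘ (ℤ.+ suc ℤ.∣ i ∣) 0) ⟨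
    ℚ.toℚᵘ (toℚ (suc ℤ.∣ i ∣))         ∎)
    where
    open ℚᵘ.≤-Reasoning
    bound : ∀ i → i ℤ.* ℤ.+ 1 ℤ.≤ ℤ.+ suc ℤ.∣ i ∣ ℤ.* ℤ.+ suc d
    bound (ℤ.+ n)    = subst (ℤ._≤ ℤ.+ suc n ℤ.* ℤ.+ suc d) (sym (ℤ.*-identityʳ (ℤ.+ n)))
      (ℤ.+≤+ (≤-trans (n≤1+n n) (m≤m*n (suc n) (suc d))))
    bound -[1+ n ] = ℤ.-≤+

_⊕_ : ∀ {r} → Pt r → Pt r → Pt r
(x₁ , x₂) ⊕ (y₁ , y₂) = (λ i → x₁ i ℚ.+ y₁ i) , (λ i → x₂ i ℚ.+ y₂ i)

_⊙_ : ∀ {r} → ℚ → Pt r → Pt r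
c ⊙ (x₁ , x₂) = (λ i → c ℚ.* x₁ i) , (λ i → c ℚ.* x₂ i)

infixl 6 _⊕_
infixr 7 _⊙_

𝟎 : ∀ {r} → Pt r
𝟎 = (λ _ → 0ℚ) , (λ _ → 0ℚ)

≈-trans : ∀ {r} (x y z : Pt r) → x ≈P y → y ≈P z → x ≈P z
≈-trans x y z (p₁ , p₂) (q₁ , q₂) = (λ i → trans (p₁ i) (q₁ i)) , (λ i → trans (p₂ i) (q₂ i))

≈-sym : ∀ {r} (x y : Pt r) → x ≈P y → y ≈P x
≈-sym x y (p₁ , p₂) = (λ i → sym (p₁ i)) , (λ i → sym (p₂ i))

record Linear {r} (F : Pt r → ℚ) : Set where
  field
    F-cong  : ∀ x y → x ≈P y → F x ≡ F y
    add   : ∀ x y → F (x ⊕ y) ≡ F x ℚ.+ F y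
    scale : ∀ c x → F (c ⊙ x) ≡ c ℚ.* F x

  F-𝟎 : F 𝟎 ≡ 0ℚ
  F-𝟎 = trans (F-cong 𝟎 (0ℚ ⊙ 𝟎) ((λ _ → refl) , (λ _ → refl))) (trans (scale 0ℚ 𝟎) (ℚ.*-zeroˡ (F 𝟎)))

open Linear

sumℚ-cong : ∀ {k} {f g : Fin k → ℚ} → (∀ i → f i ≡ g i) → sumℚ f ≡ sumℚ g
sumℚ-cong {zero}  h = refl
sumℚ-cong {suc k} h = cong₂ ℚ._+_ (h zero) (sumℚ-cong (h ∘ suc))

sumℚ-+ : ∀ {k} (f g : Fin k → ℚ) → sumℚ (λ i → f i ℚ.+ g i) ≡ sumℚ f ℚ.+ sumℚ g
sumℚ-+ {zero}  f g = refl
sumℚ-+ {suc k} f g rewrite sumℚ-+ (f ∘ suc) (g ∘ suc) =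
  ℚS.solve 4 (λ a b c d → a :+ b :+ (c :+ d) := a :+ c :+ (b :+ d)) refl
    (f zero) (g zero) (sumℚ (f ∘ suc)) (sumℚ (g ∘ suc))
  where open ℚS

sumℚ-* : ∀ {k} c (f : Fin k → ℚ) → sumℚ (λ i → c ℚ.* f i) ≡ c ℚ.* sumℚ f
sumℚ-* {zero}  c f = sym (ℚ.*-zeroʳ c)
sumℚ-* {suc k} c f rewrite sumℚ-* c (f ∘ suc) = sym (ℚ.*-distribˡ-+ c (f zero) (sumℚ (f ∘ suc)))

dot-linear : ∀ {r} (a : Pt r) → Linear (dot a)
dot-linear (a₁ , a₂) = record
  { F-cong  = λ { _ _ (p , q) → cong₂ ℚ._+_ (sumℚ-cong (λ i → cong (a₁ i ℚ.*_) (p i)))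
                                          (sumℚ-cong (λ i → cong (a₂ i ℚ.*_) (q i))) }
  ; add   = λ { (x₁ , x₂) (y₁ , y₂) →
      trans (cong₂ ℚ._+_ (half-add a₁ x₁ y₁) (half-add a₂ x₂ y₂))
        (ℚS.solve 4 (λ a b c d → a :+ b :+ (c :+ d) := a :+ c :+ (b :+ d)) refl
          (sumℚ (λ i → a₁ i ℚ.* x₁ i)) (sumℚ (λ i → a₁ i ℚ.* y₁ i))
          (sumℚ (λ i → a₂ i ℚ.* x₂ i)) (sumℚ (λ i → a₂ i ℚ.* y₂ i))) }
  ; scale = λ { c (x₁ , x₂) →
      trans (cong₂ ℚ._+_ (half-scale c a₁ x₁) (half-scale c a₂ x₂))
        (sym (ℚ.*-distribˡ-+ c (sumℚ (λ i → a₁ i ℚ.* x₁ i)) (sumℚ (λ i → a₂ i ℚ.* x₂ i)))) }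
  }
  where
  open ℚS
  half-add : ∀ {r} (a x y : Fin r → ℚ) →
    sumℚ (λ i → a i ℚ.* (x i ℚ.+ y i)) ≡ sumℚ (λ i → a i ℚ.* x i) ℚ.+ sumℚ (λ i → a i ℚ.* y i)
  half-add a x y = trans (sumℚ-cong (λ i → ℚ.*-distribˡ-+ (a i) (x i) (y i)))
    (sumℚ-+ (λ i → a i ℚ.* x i) (λ i → a i ℚ.* y i))
  half-scale : ∀ {r} c (a x : Fin r → ℚ) →
    sumℚ (λ i → a i ℚ.* (c ℚ.* x i)) ≡ c ℚ.* sumℚ (λ i → a i ℚ.* x i)
  half-scale c a x = trans (sumℚ-cong (λ i → ℚS.solve 3 (λ a c x → a :* (c :* x) := c :* (a :* x)) refl (a i) c (x i)))
    (sumℚ-* c (λ i → a i ℚ.* x i))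

coordSum-linear : ∀ {r} → Linear (coordSum {r})
coordSum-linear = record
  { F-cong  = λ { _ _ (p , q) → cong₂ ℚ._+_ (sumℚ-cong p) (sumℚ-cong q) }
  ; add   = λ { (x₁ , x₂) (y₁ , y₂) → trans (cong₂ ℚ._+_ (sumℚ-+ x₁ y₁) (sumℚ-+ x₂ y₂))
      (ℚS.solve 4 (λ a b c d → a :+ b :+ (c :+ d) := a :+ c :+ (b :+ d)) refl
        (sumℚ x₁) (sumℚ y₁) (sumℚ x₂) (sumℚ y₂)) }
  ; scale = λ { c (x₁ , x₂) → trans (cong₂ ℚ._+_ (sumℚ-* c x₁) (sumℚ-* c x₂))
      (sym (ℚ.*-distribˡ-+ c (sumℚ x₁) (sumℚ x₂))) }
  }
  where open ℚS

combine-linear : ∀ {r} {F G : Pt r → ℚ} b → Linear F → Linear G → Linear (λ x → b ℚ.* F x ℚ.- G x)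
combine-linear {F = F} {G} b lF lG = record
  { F-cong  = λ x y p → cong₂ (λ f g → b ℚ.* f ℚ.- g) (F-cong lF x y p) (F-cong lG x y p)
  ; add   = λ x y → trans (cong₂ (λ f g → b ℚ.* f ℚ.- g) (add lF x y) (add lG x y))
      (ℚS.solve 5 (λ b f f′ g g′ → b :* (f :+ f′) :- (g :+ g′) := b :* f :- g :+ (b :* f′ :- g′)) refl
        b (F x) (F y) (G x) (G y))
  ; scale = λ c x → trans (cong₂ (λ f g → b ℚ.* f ℚ.- g) (scale lF c x) (scale lG c x))
      (ℚS.solve 4 (λ b c f g → b :* (c :* f) :- c :* g := c :* (b :* f :- g)) refl b c (F x) (G x))
  }
  where open ℚS

linear-combo-zero : ∀ {r} {F : Pt r → ℚ} → Linear F → ∀ {k} (c : Fin k → ℚ) (p : Fin k → Pt r) →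
                    (∀ j → F (p j) ≡ 0ℚ) → F (combo c p) ≡ 0ℚ
linear-combo-zero lF {zero}  c p h = F-𝟎 lF
linear-combo-zero {F = F} lF {suc k} c p h = begin
  F (combo c p)                                            ≡⟨ add lF (c zero ⊙ p zero) (combo (c ∘ suc) (p ∘ suc)) ⟩
  F (c zero ⊙ p zero) ℚ.+ F (combo (c ∘ suc) (p ∘ suc))    ≡⟨ cong₂ ℚ._+_ (scale lF (c zero) (p zero)) (linear-combo-zero lF (c ∘ suc) (p ∘ suc) (h ∘ suc)) ⟩
  c zero ℚ.* F (p zero) ℚ.+ 0ℚ                             ≡⟨ ℚ.+-identityʳ _ ⟩
  c zero ℚ.* F (p zero)                                    ≡⟨ cong (c zero ℚ.*_) (h zero) ⟩
  c zero ℚ.* 0ℚ                                            ≡⟨ ℚ.*-zeroʳ (c zero) ⟩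
  0ℚ                                                       ∎
  where open ≡-Reasoning

data Independent {r} : List (Pt r) → Set where
  []  : Independent []
  sep : ∀ {p ps} (F : Pt r → ℚ) → Linear F → 0ℚ ℚ.< F p → All (λ q → F q ≡ 0ℚ) ps →
        Independent ps → Independent (p ∷ ps)

independent⇒≡0 : ∀ {r} {ps : List (Pt r)} → Independent ps → ∀ c → combo c (lookup ps) ≈P 𝟎 → ∀ j → c j ≡ 0ℚ
independent⇒≡0 {ps = p ∷ ps} (sep F lF Fp>0 Fps≡0 ind) c h = λ { zero → c₀≡0 ; (suc j) → independent⇒≡0 ind (c ∘ suc) h′ j }
  where
  open ≡-Reasoning
  rest = combo (c ∘ suc) (lookup ps)
  c₀≡0 : c zero ≡ 0ℚ
  c₀≡0 = pos-cancel-≡ Fp>0 (begin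
    F p ℚ.* c zero                    ≡⟨ ℚ.*-comm (F p) (c zero) ⟩
    c zero ℚ.* F p                    ≡⟨ sym (ℚ.+-identityʳ _) ⟩
    c zero ℚ.* F p ℚ.+ 0ℚ             ≡⟨ cong₂ ℚ._+_ (sym (scale lF (c zero) p)) (sym (linear-combo-zero lF (c ∘ suc) (lookup ps) (λ j → All.lookup Fps≡0 (∈-lookup j)))) ⟩
    F (c zero ⊙ p) ℚ.+ F rest         ≡⟨ sym (add lF (c zero ⊙ p) rest) ⟩
    F (c zero ⊙ p ⊕ rest)             ≡⟨ F-cong lF (c zero ⊙ p ⊕ rest) 𝟎 h ⟩
    F 𝟎                               ≡⟨ F-𝟎 lF ⟩
    0ℚ                                ∎)
  strip : ∀ {x y} → c zero ℚ.* x ℚ.+ y ≡ 0ℚ → y ≡ 0ℚ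
  strip {x} {y} e = trans (sym (trans (cong (λ z → z ℚ.* x ℚ.+ y) c₀≡0) (trans (cong (ℚ._+ y) (ℚ.*-zeroˡ x)) (ℚ.+-identityˡ y)))) e
  h′ : rest ≈P 𝟎
  h′ = (λ i → strip (proj₁ h i)) , (λ i → strip (proj₂ h i))

-- Linear independence implies affine independence. The hypothesis excludes only families of exactly
-- d + 2 points, so longer lists are first cut down to their tails.
independent⇒length≤ : ∀ {r d} {F : Pt r → Set} →
  (∀ (p : Fin (suc (suc d)) → Pt r) → (∀ j → F (p j)) → ¬ AffinelyIndependent p) →
  ∀ {ps} → Independent ps → All F ps → length ps ≤ suc d
independent⇒length≤ max {[]} _ _ = z≤n
independent⇒length≤ {r} {d} {F} max {p ∷ ps} ind@(sep _ _ _ _ ind′) all@(_ ∷ all′) =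
  ≤∧≢⇒< (independent⇒length≤ max ind′ all′) λ eq → large max (p ∷ ps) (cong suc eq) ind all
  where
  large : ∀ {n} → (∀ (p : Fin n → Pt r) → (∀ j → F (p j)) → ¬ AffinelyIndependent p) →
          ∀ qs → length qs ≡ n → Independent qs → ¬ All F qs
  large max qs refl ind all = max (lookup qs) (λ j → All.lookup all (∈-lookup j))
    (λ c _ → independent⇒≡0 ind c)

-- Drops of finite sequences as linear functionals.

extend : ∀ {A : Set} {r} → A → (Fin r → A) → ℕ → A
extend {r = zero}  z f n       = z
extend {r = suc r} z f zero    = f zero
extend {r = suc r} z f (suc n) = extend z (f ∘ suc) n

extend-toℕ : ∀ {A : Set} {r} {z : A} (f : Fin r → A) i → extend z f (toℕ i) ≡ f i
extend-toℕ f zero    = refl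
extend-toℕ f (suc i) = extend-toℕ (f ∘ suc) i

extend-restrict : ∀ {A B : Set} (h : A → B) {z} r (g : ℕ → A) → (∀ n → r ≤ n → h (g n) ≡ z) →
                  ∀ n → extend {r = r} z (h ∘ g ∘ toℕ) n ≡ h (g n)
extend-restrict h zero    g end n       = sym (end n z≤n)
extend-restrict h (suc r) g end zero    = refl
extend-restrict h (suc r) g end (suc n) = extend-restrict h r (g ∘ suc) (λ m r≤m → end (suc m) (s≤s r≤m)) n

-- The coefficient of ω_(n+1) when f is expanded in the basis of the ω_j. The default value 0 past
-- the end makes the coefficient of ω_r a drop too.
kink : ∀ {r} → ℕ → (Fin r → ℚ) → ℚ
kink n f = extend 0ℚ f n ℚ.- extend 0ℚ f (suc n)

extend-cong : ∀ {r} {f g : Fin r → ℚ} → (∀ i → f i ≡ g i) → ∀ n → extend 0ℚ f n ≡ extend 0ℚ g n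
extend-cong {zero}  h n       = refl
extend-cong {suc r} h zero    = h zero
extend-cong {suc r} h (suc n) = extend-cong (h ∘ suc) n

extend-+ : ∀ {r} (f g : Fin r → ℚ) n → extend 0ℚ (λ i → f i ℚ.+ g i) n ≡ extend 0ℚ f n ℚ.+ extend 0ℚ g n
extend-+ {zero}  f g n       = refl
extend-+ {suc r} f g zero    = refl
extend-+ {suc r} f g (suc n) = extend-+ (f ∘ suc) (g ∘ suc) n

extend-* : ∀ {r} c (f : Fin r → ℚ) n → extend 0ℚ (λ i → c ℚ.* f i) n ≡ c ℚ.* extend 0ℚ f n
extend-* {zero}  c f n       = sym (ℚ.*-zeroʳ c)
extend-* {suc r} c f zero    = refl
extend-* {suc r} c f (suc n) = extend-* c (f ∘ suc) n

kink-cong : ∀ {r} n {f g : Fin r → ℚ} → (∀ i → f i ≡ g i) → kink n f ≡ kink n g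
kink-cong n h = cong₂ ℚ._-_ (extend-cong h n) (extend-cong h (suc n))

kink-+ : ∀ {r} n (f g : Fin r → ℚ) → kink n (λ i → f i ℚ.+ g i) ≡ kink n f ℚ.+ kink n g
kink-+ n f g rewrite extend-+ f g n | extend-+ f g (suc n) =
  ℚS.solve 4 (λ a b c d → a :+ b :- (c :+ d) := a :- c :+ (b :- d)) refl
    (extend 0ℚ f n) (extend 0ℚ g n) (extend 0ℚ f (suc n)) (extend 0ℚ g (suc n))
  where open ℚS

kink-* : ∀ {r} n c (f : Fin r → ℚ) → kink n (λ i → c ℚ.* f i) ≡ c ℚ.* kink n f
kink-* n c f rewrite extend-* c f n | extend-* c f (suc n) =
  ℚS.solve 3 (λ c a b → c :* a :- c :* b := c :* (a :- b)) refl c (extend 0ℚ f n) (extend 0ℚ f (suc n))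
  where open ℚS

kink₁-linear : ∀ {r} n → Linear {r} (λ x → kink n (proj₁ x))
kink₁-linear n = record
  { F-cong = λ _ _ p → kink-cong n (proj₁ p) ; add = λ x y → kink-+ n (proj₁ x) (proj₁ y) ; scale = λ c x → kink-* n c (proj₁ x) }

kink₂-linear : ∀ {r} n → Linear {r} (λ x → kink n (proj₂ x))
kink₂-linear n = record
  { F-cong = λ _ _ p → kink-cong n (proj₂ p) ; add = λ x y → kink-+ n (proj₂ x) (proj₂ y) ; scale = λ c x → kink-* n c (proj₂ x) }

steps : ∀ {r} → ℕ → Fin r → ℚ
steps j i = ι (ind j (toℕ i))

kink-steps≡1 : ∀ {r n} → suc n ≤ r → kink {r} n (steps (suc n)) ≡ 1ℚ
kink-steps≡1 {r} {n} n<r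
  rewrite extend-restrict ι r (ind (suc n)) (λ m r≤m → trans (cong ι (ind-≥ (≤-trans n<r r≤m))) ι0≡0) n
        | extend-restrict ι r (ind (suc n)) (λ m r≤m → trans (cong ι (ind-≥ (≤-trans n<r r≤m))) ι0≡0) (suc n)
        | ind-< {suc n} {n} ≤-refl | ind-≥ {suc n} {suc n} ≤-refl | ι1≡1 | ι0≡0 = refl

kink-steps≡0 : ∀ {r n j} → j ≤ r → suc n ≢ j → kink {r} n (steps j) ≡ 0ℚ
kink-steps≡0 {r} {n} {j} j≤r ≢j
  rewrite extend-restrict ι r (ind j) (λ m r≤m → trans (cong ι (ind-≥ (≤-trans j≤r r≤m))) ι0≡0) n
        | extend-restrict ι r (ind j) (λ m r≤m → trans (cong ι (ind-≥ (≤-trans j≤r r≤m))) ι0≡0) (suc n)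
        | ind-flat ≢j = ℚ.+-inverseʳ (ι (ind j n))

point : ∀ r → (ℕ → ℕ) → (ℕ → ℕ) → Pt r
point r l m = (λ i → ι (l (toℕ i))) , (λ i → ι (m (toℕ i)))

unit₁ unit₂ : ∀ {r} → ℕ → Pt r
unit₁ j = steps j , (λ _ → 0ℚ)
unit₂ j = (λ _ → 0ℚ) , steps j

rayPoint : ∀ r → Ray → Pt r
rayPoint r t = point r (upper t) (lower t)

linear-ray : ∀ {r} {F : Pt r → ℚ} → Linear F → ∀ t → F (rayPoint r t) ≡ pairing (F ∘ unit₁) (F ∘ unit₂) t
linear-ray {r} {F} lF t = begin
  F (rayPoint r t)
    ≡⟨ F-cong lF (rayPoint r t) (ι (w t) ⊙ eⱼ ⊕ (ι (wl t) ⊙ eᵢ ⊕ ι (wr t) ⊙ eₖ))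
         ( (λ i → trans (ι-* (w t) (ind (mid t) (toℕ i)))
             (ℚS.solve 3 (λ x a b → x := x :+ (a :* con 0ℚ :+ b :* con 0ℚ)) refl _ (ι (wl t)) (ι (wr t))))
         , (λ i → trans (ι-+ (wl t * ind (left t) (toℕ i)) (wr t * ind (right t) (toℕ i)))
             (trans (cong₂ ℚ._+_ (ι-* (wl t) (ind (left t) (toℕ i))) (ι-* (wr t) (ind (right t) (toℕ i))))
               (ℚS.solve 3 (λ x y a → x :+ y := a :* con 0ℚ :+ (x :+ y)) refl
                 (ι (wl t) ℚ.* ι (ind (left t) (toℕ i))) (ι (wr t) ℚ.* ι (ind (right t) (toℕ i))) (ι (w t))))) ) ⟩
  F (ι (w t) ⊙ eⱼ ⊕ (ι (wl t) ⊙ eᵢ ⊕ ι (wr t) ⊙ eₖ))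
    ≡⟨ trans (add lF (ι (w t) ⊙ eⱼ) (ι (wl t) ⊙ eᵢ ⊕ ι (wr t) ⊙ eₖ))
         (cong (F (ι (w t) ⊙ eⱼ) ℚ.+_) (add lF (ι (wl t) ⊙ eᵢ) (ι (wr t) ⊙ eₖ))) ⟩
  F (ι (w t) ⊙ eⱼ) ℚ.+ (F (ι (wl t) ⊙ eᵢ) ℚ.+ F (ι (wr t) ⊙ eₖ))
    ≡⟨ cong₂ ℚ._+_ (scale lF (ι (w t)) eⱼ) (cong₂ ℚ._+_ (scale lF (ι (wl t)) eᵢ) (scale lF (ι (wr t)) eₖ)) ⟩
  ι (w t) ℚ.* F eⱼ ℚ.+ (ι (wl t) ℚ.* F eᵢ ℚ.+ ι (wr t) ℚ.* F eₖ)
    ≡⟨ cong (λ z → z ℚ.* F eⱼ ℚ.+ (ι (wl t) ℚ.* F eᵢ ℚ.+ ι (wr t) ℚ.* F eₖ)) (ι-+ (wl t) (wr t)) ⟩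
  (ι (wl t) ℚ.+ ι (wr t)) ℚ.* F eⱼ ℚ.+ (ι (wl t) ℚ.* F eᵢ ℚ.+ ι (wr t) ℚ.* F eₖ)
    ≡⟨ ℚS.solve 5 (λ a b x y z → (a :+ b) :* x :+ (a :* y :+ b :* z) := a :* (x :+ y) :+ b :* (x :+ z)) refl
         (ι (wl t)) (ι (wr t)) (F eⱼ) (F eᵢ) (F eₖ) ⟩
  pairing (F ∘ unit₁) (F ∘ unit₂) t ∎
  where
  open ≡-Reasoning
  open ℚS
  eⱼ eᵢ eₖ : Pt r
  eⱼ = unit₁ (mid t)
  eᵢ = unit₂ (left t)
  eₖ = unit₂ (right t)

kink-steps≥0 : ∀ {r n j} → j ≤ r → 0ℚ ℚ.≤ kink {r} n (steps j)
kink-steps≥0 {r} {n} {j} j≤r with suc n ≟ j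
... | yes refl = subst (0ℚ ℚ.≤_) (sym (kink-steps≡1 {r} {n} j≤r)) (ℚ.<⇒≤ (ℚ.positive⁻¹ 1ℚ))
... | no  ≢j   = ℚ.≤-reflexive (sym (kink-steps≡0 j≤r ≢j))

kink-steps>0 : ∀ {r n j} → j ≤ r → suc n ≡ j → 0ℚ ℚ.< kink {r} n (steps j)
kink-steps>0 {r} {n} j≤r refl = subst (0ℚ ℚ.<_) (sym (kink-steps≡1 {r} {n} j≤r)) (ℚ.positive⁻¹ 1ℚ)

module RayKinks (r n : ℕ) where

  K : ℕ → ℚ
  K j = kink {r} n (steps j)

  kink-upper : ∀ t → kink {r} n (proj₁ (rayPoint r t)) ≡ ι (w t) ℚ.* K (mid t)
  kink-upper t = trans (kink-cong {r} n (λ i → ι-* (w t) (ind (mid t) (toℕ i)))) (kink-* {r} n (ι (w t)) (steps (mid t)))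

  kink-lower : ∀ t → kink {r} n (proj₂ (rayPoint r t)) ≡ ι (wl t) ℚ.* K (left t) ℚ.+ ι (wr t) ℚ.* K (right t)
  kink-lower t = begin
    kink {r} n (proj₂ (rayPoint r t))
      ≡⟨ kink-cong {r} n (λ i → trans (ι-+ (wl t * ind (left t) (toℕ i)) (wr t * ind (right t) (toℕ i)))
           (cong₂ ℚ._+_ (ι-* (wl t) (ind (left t) (toℕ i))) (ι-* (wr t) (ind (right t) (toℕ i))))) ⟩
    kink {r} n (λ i → ι (wl t) ℚ.* steps (left t) i ℚ.+ ι (wr t) ℚ.* steps (right t) i)
      ≡⟨ kink-+ {r} n (λ i → ι (wl t) ℚ.* steps (left t) i) (λ i → ι (wr t) ℚ.* steps (right t) i) ⟩
    kink {r} n (λ i → ι (wl t) ℚ.* steps (left t) i) ℚ.+ kink {r} n (λ i → ι (wr t) ℚ.* steps (right t) i)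
      ≡⟨ cong₂ ℚ._+_ (kink-* {r} n (ι (wl t)) (steps (left t))) (kink-* {r} n (ι (wr t)) (steps (right t))) ⟩
    ι (wl t) ℚ.* K (left t) ℚ.+ ι (wr t) ℚ.* K (right t) ∎
    where open ≡-Reasoning

  mid≤r : ∀ t → Ok r t → mid t ≤ r
  mid≤r t ok = ≤-trans (mid≤right t ok) (right≤r t ok)

  kink-upper>0 : ∀ t → Ok r t → suc n ≡ mid t → 0ℚ ℚ.< kink {r} n (proj₁ (rayPoint r t))
  kink-upper>0 t ok eq = subst (0ℚ ℚ.<_) (sym (kink-upper t)) (*-pos (ι-pos (w>0 t ok)) (kink-steps>0 {r} {n} (mid≤r t ok) eq))

  kink-upper≡0 : ∀ t → Ok r t → suc n ≢ mid t → kink {r} n (proj₁ (rayPoint r t)) ≡ 0ℚ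
  kink-upper≡0 t ok ≢j = trans (kink-upper t)
    (trans (cong (ι (w t) ℚ.*_) (kink-steps≡0 {r} {n} (mid≤r t ok) ≢j)) (ℚ.*-zeroʳ (ι (w t))))

  kink-lower≡0 : ∀ t → Ok r t → ¬ (suc n ≡ left t ⊎ suc n ≡ right t) → kink {r} n (proj₂ (rayPoint r t)) ≡ 0ℚ
  kink-lower≡0 t ok ≢ = trans (kink-lower t)
    (trans (cong₂ (λ x y → ι (wl t) ℚ.* x ℚ.+ ι (wr t) ℚ.* y)
              (kink-steps≡0 {r} {n} (≤-trans (left≤mid t ok) (mid≤r t ok)) (≢ ∘ inj₁)) (kink-steps≡0 {r} {n} (right≤r t ok) (≢ ∘ inj₂)))
      (cong₂ ℚ._+_ (ℚ.*-zeroʳ (ι (wl t))) (ℚ.*-zeroʳ (ι (wr t)))))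

  kink-lower>0 : ∀ t → Ok r t → suc n ≡ left t ⊎ suc n ≡ right t → 0ℚ ℚ.< kink {r} n (proj₂ (rayPoint r t))
  kink-lower>0 t ok eq = subst (0ℚ ℚ.<_) (sym (kink-lower t)) (positive t ok eq)
    where
    positive : ∀ t → Ok r t → suc n ≡ left t ⊎ suc n ≡ right t →
               0ℚ ℚ.< ι (wl t) ℚ.* K (left t) ℚ.+ ι (wr t) ℚ.* K (right t)
    positive (dg j) (_ , j≤r) eq =
      ℚ.+-mono-<-≤ (*-pos (ι-pos (s≤s z≤n)) (kink-steps>0 {r} {n} j≤r (reduce eq))) (*-nonNeg (ι-nonNeg 0) (kink-steps≥0 {r} {n} j≤r))
    positive (tr i j k) (i<j , j<k , k≤r) (inj₁ e) =
      ℚ.+-mono-<-≤ (*-pos (ι-pos (m<n⇒0<n∸m j<k)) (kink-steps>0 {r} {n} (<⇒≤ (<-trans i<j (<-≤-trans j<k k≤r))) e))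
        (*-nonNeg (ι-nonNeg (j ∸ i)) (kink-steps≥0 {r} {n} k≤r))
    positive (tr i j k) (i<j , j<k , k≤r) (inj₂ e) =
      ℚ.+-mono-≤-< (*-nonNeg (ι-nonNeg (k ∸ j)) (kink-steps≥0 {r} {n} (<⇒≤ (<-trans i<j (<-≤-trans j<k k≤r)))))
        (*-pos (ι-pos (m<n⇒0<n∸m i<j)) (kink-steps>0 {r} {n} k≤r e))

-- The Kostka cone

opaque
  recip : ℕ → ℚ
  recip zero    = 0ℚ
  recip (suc n) = proj₁ (pos⇒inverse (ι-pos {suc n} (s≤s z≤n)))

  recip-pos : ∀ {n} → 0 < n → 0ℚ ℚ.< recip n
  recip-pos {suc n} _ = proj₁ (proj₂ (pos⇒inverse (ι-pos {suc n} (s≤s z≤n))))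

  recip-inverse : ∀ {n} → 0 < n → ι n ℚ.* recip n ≡ 1ℚ
  recip-inverse {suc n} _ = proj₂ (proj₂ (pos⇒inverse (ι-pos {suc n} (s≤s z≤n))))

psum-front : ∀ f n → psum f (suc n) ≡ f 0 + psum (f ∘ suc) n
psum-front f zero    = sym (+-identityʳ (f 0))
psum-front f (suc n) = trans (cong (_+ f (suc n)) (psum-front f n)) (+-assoc (f 0) (psum (f ∘ suc) n) (f (suc n)))

psum-0 : ∀ n → psum (λ _ → 0) n ≡ 0
psum-0 zero    = refl
psum-0 (suc n) = trans (+-identityʳ _) (psum-0 n)

prefixSum-extend : ∀ {r} (l : Fin r → ℕ) k → prefixSum l k ≡ psum (extend 0 l) k
prefixSum-extend {zero}  l k       = sym (psum-0 k)
prefixSum-extend {suc r} l zero    = refl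
prefixSum-extend {suc r} l (suc k) =
  trans (cong (λ z → l zero + z) (prefixSum-extend (l ∘ suc) k)) (sym (psum-front (extend 0 l) k))

sumℕ-extend : ∀ {r} (l : Fin r → ℕ) → sumℕ l ≡ psum (extend 0 l) r
sumℕ-extend {zero}  l = refl
sumℕ-extend {suc r} l = trans (cong (λ z → l zero + z) (sumℕ-extend (l ∘ suc))) (sym (psum-front (extend 0 l) r))

prefixSum-toℕ : ∀ {r} (g : ℕ → ℕ) {k} → k ≤ r → prefixSum {r} (g ∘ toℕ) k ≡ psum g k
prefixSum-toℕ {zero}  g z≤n             = refl
prefixSum-toℕ {suc r} g {zero}  _         = refl
prefixSum-toℕ {suc r} g {suc k} (s≤s k≤r) =
  trans (cong (λ z → g 0 + z) (prefixSum-toℕ (g ∘ suc) k≤r)) (sym (psum-front g k))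

sumℕ-toℕ : ∀ r (g : ℕ → ℕ) → sumℕ {r} (g ∘ toℕ) ≡ psum g r
sumℕ-toℕ zero    g = refl
sumℕ-toℕ (suc r) g = trans (cong (λ z → g 0 + z) (sumℕ-toℕ r (g ∘ suc))) (sym (psum-front g r))

sumℚ-ι : ∀ r (g : ℕ → ℕ) → sumℚ {r} (λ i → ι (g (toℕ i))) ≡ ι (psum g r)
sumℚ-ι zero    g = sym ι0≡0
sumℚ-ι (suc r) g = trans (cong (λ z → ι (g 0) ℚ.+ z) (sumℚ-ι r (g ∘ suc)))
  (trans (sym (ι-+ (g 0) (psum (g ∘ suc) r))) (cong ι (sym (psum-front g r))))

extend-end : ∀ {r} (l : Fin r → ℕ) → extend 0 l r ≡ 0
extend-end {zero}  l = refl
extend-end {suc r} l = extend-end (l ∘ suc)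

extend-antitone : ∀ {r} (l : Fin r → ℕ) → IsPartition l → Antitone (extend 0 l)
extend-antitone {zero}        l part n       = z≤n
extend-antitone {suc zero}    l part zero    = z≤n
extend-antitone {suc (suc r)} l part zero    = part zero (suc zero) z≤n
extend-antitone {suc r}       l part (suc n) = extend-antitone (l ∘ suc) (λ i j i≤j → part (suc i) (suc j) (s≤s i≤j)) n

gen⇒pair : ∀ {r x} → KostkaGen r x → ∃[ l ] ∃[ m ] (KostkaPair r l m × x ≈P point r l m)
gen⇒pair {r} {x} (l , m , part-l , part-m , sums , dominates , (x₁≡ , x₂≡)) =
  extend 0 l , extend 0 m ,
  record
    { l-anti = extend-antitone l part-l
    ; m-anti = extend-antitone m part-m
    ; l-end  = extend-end l
    ; m-end  = extend-end m
    ; total  = trans (sym (sumℕ-extend l)) (trans sums (sumℕ-extend m))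
    ; dom    = λ k k≤r → subst₂ _≤_ (prefixSum-extend m k) (prefixSum-extend l k) (dominates k k≤r)
    } ,
  (λ i → trans (x₁≡ i) (toι l i)) , (λ i → trans (x₂≡ i) (toι m i))
  where
  toι : ∀ (l : Fin r → ℕ) i → toℚ (l i) ≡ ι (extend 0 l (toℕ i))
  toι l i = trans (sym (ι≡toℚ (l i))) (cong ι (sym (extend-toℕ l i)))

pair⇒gen : ∀ {r l m} → KostkaPair r l m → KostkaGen r (point r l m)
pair⇒gen {r} {l} {m} lm =
  l ∘ toℕ , m ∘ toℕ , (λ i j → antitone-≤ l-anti) , (λ i j → antitone-≤ m-anti) ,
  trans (sumℕ-toℕ r l) (trans total (sym (sumℕ-toℕ r m))) ,
  (λ k k≤r → subst₂ _≤_ (sym (prefixSum-toℕ m k≤r)) (sym (prefixSum-toℕ l k≤r)) (dom k k≤r)) ,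
  (λ i → ι≡toℚ (l (toℕ i))) , (λ i → ι≡toℚ (m (toℕ i)))
  where open KostkaPair lm

scale-pair : ∀ {r l m} N → KostkaPair r l m → KostkaPair r (λ n → N * l n) (λ n → N * m n)
scale-pair {r} {l} {m} N lm = record
  { l-anti = λ n → *-monoʳ-≤ N (l-anti n)
  ; m-anti = λ n → *-monoʳ-≤ N (m-anti n)
  ; l-end  = trans (cong (N *_) l-end) (*-zeroʳ N)
  ; m-end  = trans (cong (N *_) m-end) (*-zeroʳ N)
  ; total  = trans (psum-* N l r) (trans (cong (N *_) total) (sym (psum-* N m r)))
  ; dom    = λ x x≤r → subst₂ _≤_ (sym (psum-* N m x)) (sym (psum-* N l x)) (*-monoʳ-≤ N (dom x x≤r))
  }
  where open KostkaPair lm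

zero-pair : ∀ r → KostkaPair r (λ _ → 0) (λ _ → 0)
zero-pair r = record
  { l-anti = λ _ → z≤n ; m-anti = λ _ → z≤n ; l-end = refl ; m-end = refl ; total = refl ; dom = λ _ _ → ≤-refl }

-- Unlike in the convex hull, the coefficients need not add up to 1, so a ray can be split off or a
-- point rescaled without renormalising.
data Cone {r} : Pt r → Set where
  nil  : ∀ {x} → x ≈P 𝟎 → Cone x
  cons : ∀ {x} c l m y → 0ℚ ℚ.≤ c → KostkaPair r l m → Cone y → x ≈P (c ⊙ point r l m ⊕ y) → Cone x

cone-scale : ∀ {r s} {x : Pt r} → 0ℚ ℚ.≤ s → Cone x → Cone (s ⊙ x)
cone-scale {s = s} 0≤s (nil (p , q)) =
  nil ((λ i → trans (cong (s ℚ.*_) (p i)) (ℚ.*-zeroʳ s)) , (λ i → trans (cong (s ℚ.*_) (q i)) (ℚ.*-zeroʳ s)))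
cone-scale {r} {s} {x} 0≤s (cons c l m y 0≤c lm C (p , q)) =
  cons (s ℚ.* c) l m (s ⊙ y) (*-nonNeg 0≤s 0≤c) lm (cone-scale 0≤s C) ((λ i → step (p i)) , (λ i → step (q i)))
  where
  open ℚS
  step : ∀ {x a y} → x ≡ c ℚ.* a ℚ.+ y → s ℚ.* x ≡ s ℚ.* c ℚ.* a ℚ.+ s ℚ.* y
  step {x} {a} {y} e = trans (cong (s ℚ.*_) e) (ℚS.solve 4 (λ s c a y → s :* (c :* a :+ y) := s :* c :* a :+ s :* y) refl s c a y)

hull⇒cone : ∀ {r x} → KostkaCone r x → Cone x
hull⇒cone {r} {x} (k , c , p , gens , c≥0 , _ , x≈) = go k c p gens c≥0 x≈
  where
  go : ∀ {x} k (c : Fin k → ℚ) (p : Fin k → Pt r) → (∀ j → KostkaGen r (p j)) → (∀ j → 0ℚ ℚ.≤ c j) → x ≈P combo c p → Cone x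
  go zero    c p gens c≥0 x≈ = nil x≈
  go {x} (suc k) c p gens c≥0 x≈ with l , m , lm , (p₁ , p₂) ← gen⇒pair {x = p zero} (gens zero) =
    cons (c zero) l m (combo (c ∘ suc) (p ∘ suc)) (c≥0 zero) lm
      (go k (c ∘ suc) (p ∘ suc) (gens ∘ suc) (c≥0 ∘ suc) ((λ _ → refl) , (λ _ → refl)))
      ( (λ i → trans (proj₁ x≈ i) (cong (λ z → c zero ℚ.* z ℚ.+ proj₁ (combo (c ∘ suc) (p ∘ suc)) i) (p₁ i)))
      , (λ i → trans (proj₂ x≈ i) (cong (λ z → c zero ℚ.* z ℚ.+ proj₂ (combo (c ∘ suc) (p ∘ suc)) i) (p₂ i))) )

weight : ∀ {r} {x : Pt r} → Cone x → ℚ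
weight (nil _)                 = 0ℚ
weight (cons c _ _ _ _ _ C _)  = c ℚ.+ weight C

-- Scaling the partitions up by N and the coefficients down by N brings the total of the
-- coefficients below 1; the generator 0 absorbs the rest.
cone⇒hull : ∀ {r x} → Cone x → KostkaCone r x
cone⇒hull {r} {x} C with N , N>0 , weight≤N ← archimedean (weight C) = hull
  where
  open ≡-Reasoning
  open ℚS
  s = recip N
  Scaled : ∀ {x} → Cone x → Set
  Scaled {x} C = ∃[ k ] Σ[ c ∈ (Fin k → ℚ) ] Σ[ p ∈ (Fin k → Pt r) ]
    ((∀ j → KostkaGen r (p j)) × (∀ j → 0ℚ ℚ.≤ c j) × sumℚ c ≡ s ℚ.* weight C × x ≈P combo c p)
  step : ∀ {x c y y′} a → x ≡ c ℚ.* ι a ℚ.+ y → y ≡ y′ → x ≡ s ℚ.* c ℚ.* ι (N * a) ℚ.+ y′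
  step {x} {c} {y} a e refl = trans e (cong (ℚ._+ y) (sym (begin
    s ℚ.* c ℚ.* ι (N * a)           ≡⟨ cong (s ℚ.* c ℚ.*_) (ι-* N a) ⟩
    s ℚ.* c ℚ.* (ι N ℚ.* ι a)       ≡⟨ ℚS.solve 4 (λ s c n a → s :* c :* (n :* a) := n :* s :* (c :* a)) refl s c (ι N) (ι a) ⟩
    ι N ℚ.* s ℚ.* (c ℚ.* ι a)       ≡⟨ cong (ℚ._* (c ℚ.* ι a)) (recip-inverse N>0) ⟩
    1ℚ ℚ.* (c ℚ.* ι a)              ≡⟨ ℚ.*-identityˡ (c ℚ.* ι a) ⟩
    c ℚ.* ι a                       ∎)))
  scaled : ∀ {x} (C : Cone x) → Scaled C
  scaled (nil x≈) = 0 , (λ ()) , (λ ()) , (λ ()) , (λ ()) , sym (ℚ.*-zeroʳ s) , x≈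
  scaled (cons c l m y 0≤c lm C (p₁ , p₂)) with k , cs , ps , gens , cs≥0 , sum , (q₁ , q₂) ← scaled C =
    suc k , (s ℚ.* c V.∷ cs) , (point r (λ n → N * l n) (λ n → N * m n) V.∷ ps) ,
    (λ { zero → pair⇒gen (scale-pair N lm) ; (suc j) → gens j }) ,
    (λ { zero → *-nonNeg (ℚ.<⇒≤ (recip-pos N>0)) 0≤c ; (suc j) → cs≥0 j }) ,
    trans (cong (s ℚ.* c ℚ.+_) sum) (sym (ℚ.*-distribˡ-+ s c (weight C))) ,
    (λ i → step (l (toℕ i)) (p₁ i) (q₁ i)) , (λ i → step (m (toℕ i)) (p₂ i) (q₂ i))
  hull : KostkaCone r x
  hull with k , cs , ps , gens , cs≥0 , sum , (q₁ , q₂) ← scaled C =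
    suc k , (1ℚ ℚ.- s ℚ.* weight C V.∷ cs) , (point r (λ _ → 0) (λ _ → 0) V.∷ ps) ,
    (λ { zero → pair⇒gen (zero-pair r) ; (suc j) → gens j }) ,
    (λ { zero → slack ; (suc j) → cs≥0 j }) ,
    trans (cong (1ℚ ℚ.- s ℚ.* weight C ℚ.+_) sum) (ℚS.solve 1 (λ z → con 1ℚ :- z :+ z := con 1ℚ) refl (s ℚ.* weight C)) ,
    (λ i → absorb (1ℚ ℚ.- s ℚ.* weight C) (q₁ i)) , (λ i → absorb (1ℚ ℚ.- s ℚ.* weight C) (q₂ i))
    where
    absorb : ∀ {x y} c → x ≡ y → x ≡ c ℚ.* ι 0 ℚ.+ y
    absorb {x} {y} c e = trans e (sym (trans (cong (λ z → c ℚ.* z ℚ.+ y) ι0≡0)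
      (trans (cong (ℚ._+ y) (ℚ.*-zeroʳ c)) (ℚ.+-identityˡ y))))
    slack : 0ℚ ℚ.≤ 1ℚ ℚ.- s ℚ.* weight C
    slack = p≤q⇒0≤q-p (subst (s ℚ.* weight C ℚ.≤_) (trans (ℚ.*-comm s (ι N)) (recip-inverse N>0))
      (ℚ.*-monoˡ-≤-nonNeg s {{ℚ.nonNegative (ℚ.<⇒≤ (recip-pos N>0))}} weight≤N))

coordSum-point : ∀ r l m → coordSum (point r l m) ≡ ι (psum l r) ℚ.+ ι (psum m r)
coordSum-point r l m = cong₂ ℚ._+_ (sumℚ-ι r l) (sumℚ-ι r m)

coordSum-nonNeg : ∀ {r} {x : Pt r} → Cone x → 0ℚ ℚ.≤ coordSum x
coordSum-nonNeg {r} {x} (nil x≈) = ℚ.≤-reflexive (sym (trans (F-cong coordSum-linear x 𝟎 x≈) (F-𝟎 (coordSum-linear {r}))))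
coordSum-nonNeg {r} {x} (cons c l m y 0≤c lm C x≈) = subst (0ℚ ℚ.≤_) (sym (begin
  coordSum x                                          ≡⟨ F-cong coordSum-linear x (c ⊙ point r l m ⊕ y) x≈ ⟩
  coordSum (c ⊙ point r l m ⊕ y)                      ≡⟨ add coordSum-linear (c ⊙ point r l m) y ⟩
  coordSum (c ⊙ point r l m) ℚ.+ coordSum y           ≡⟨ cong (ℚ._+ coordSum y) (trans (scale coordSum-linear c (point r l m))
                                                           (cong (c ℚ.*_) (coordSum-point r l m))) ⟩
  c ℚ.* (ι (psum l r) ℚ.+ ι (psum m r)) ℚ.+ coordSum y ∎))
  (+-nonNeg (*-nonNeg 0≤c (+-nonNeg (ι-nonNeg (psum l r)) (ι-nonNeg (psum m r)))) (coordSum-nonNeg C))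
  where
  open ≡-Reasoning

pair-zero : ∀ {r l m} → KostkaPair r l m → l 0 ≡ 0 → ∀ n → l n ≡ 0 × m n ≡ 0
pair-zero {r} {l} {m} lm l0≡0 n = vanish l-anti l0≡0 n z≤n , vanish m-anti (m0≡0 r refl) n z≤n
  where
  open KostkaPair lm
  m0≡0 : ∀ s → r ≡ s → m 0 ≡ 0
  m0≡0 zero    refl = m-end
  m0≡0 (suc s) refl = n≤0⇒n≡0 (subst (m 0 ≤_) l0≡0 (dom 1 (s≤s z≤n)))

Splits : ∀ {r} → Pt r → Set
Splits {r} x = x ≈P 𝟎 ⊎ (∃[ t ] ∃[ ε ] ∃[ y ] (Ok r t × 0ℚ ℚ.< ε × Cone y × x ≈P (ε ⊙ rayPoint r t ⊕ y)))

splits-resp : ∀ {r} {x y : Pt r} → x ≈P y → Splits y → Splits x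
splits-resp {x = x} {y} x≈y (inj₁ y≈) = inj₁ (≈-trans x y 𝟎 x≈y y≈)
splits-resp {r} {x} {y} x≈y (inj₂ (t , ε , z , ok , ε>0 , D , y≈)) =
  inj₂ (t , ε , z , ok , ε>0 , D , ≈-trans x y (ε ⊙ rayPoint r t ⊕ z) x≈y y≈)

-- Zero summands are skipped; the first other one contains a ray. As `split-ray` works on `w t`
-- copies of the pair, the ray appears with coefficient c / w t.
cone-split : ∀ {r} {x : Pt r} → Cone x → Splits x
cone-split (nil x≈) = inj₁ x≈
cone-split {r} {x} (cons c l m y 0≤c lm C (p₁ , p₂)) with c ℚ.≟ 0ℚ | l 0 ≟ 0
... | yes refl | _ = splits-resp {x = x} {y} ((λ i → drop (ι (l (toℕ i))) (p₁ i)) , (λ i → drop (ι (m (toℕ i))) (p₂ i))) (cone-split C)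
  where
  drop : ∀ {x y} a → x ≡ 0ℚ ℚ.* a ℚ.+ y → x ≡ y
  drop {x} {y} a e = trans e (trans (cong (ℚ._+ y) (ℚ.*-zeroˡ a)) (ℚ.+-identityˡ y))
... | no _ | yes l0≡0 = splits-resp {x = x} {y}
    ((λ i → drop (proj₁ (pair-zero lm l0≡0 (toℕ i))) (p₁ i)) , (λ i → drop (proj₂ (pair-zero lm l0≡0 (toℕ i))) (p₂ i)))
    (cone-split C)
  where
  drop : ∀ {x n y} → n ≡ 0 → x ≡ c ℚ.* ι n ℚ.+ y → x ≡ y
  drop {x} {n} {y} refl e = trans e (trans (cong (λ z → c ℚ.* z ℚ.+ y) ι0≡0) (trans (cong (ℚ._+ y) (ℚ.*-zeroʳ c)) (ℚ.+-identityˡ y)))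
... | no c≢0 | no l0≢0 with mkSplit t ok l′ m′ lm′ l-split m-split ← split-ray lm (n≢0⇒n>0 l0≢0) =
  inj₂ (t , ε , (ε ⊙ point r l′ m′ ⊕ y) , ok , *-pos c>0 (recip-pos (w>0 t ok)) ,
    cons ε l′ m′ y (ℚ.<⇒≤ (*-pos c>0 (recip-pos (w>0 t ok)))) lm′ C ((λ _ → refl) , (λ _ → refl)) ,
    (λ i → step (l-split (toℕ i)) (p₁ i)) , (λ i → step (m-split (toℕ i)) (p₂ i)))
  where
  open ≡-Reasoning
  open ℚS
  c>0 : 0ℚ ℚ.< c
  c>0 = ℚ.≰⇒> λ c≤0 → c≢0 (ℚ.≤-antisym c≤0 0≤c)
  W = w t
  ε = c ℚ.* recip W
  step : ∀ {x n u v y} → W * n ≡ u + v → x ≡ c ℚ.* ι n ℚ.+ y → x ≡ ε ℚ.* ι u ℚ.+ (ε ℚ.* ι v ℚ.+ y)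
  step {x} {n} {u} {v} {y} e x≡ = begin
    x                                          ≡⟨ x≡ ⟩
    c ℚ.* ι n ℚ.+ y                            ≡⟨ cong (λ z → c ℚ.* z ℚ.+ y) (sym (ℚ.*-identityˡ (ι n))) ⟩
    c ℚ.* (1ℚ ℚ.* ι n) ℚ.+ y                   ≡⟨ cong (λ z → c ℚ.* (z ℚ.* ι n) ℚ.+ y) (sym (recip-inverse (w>0 t ok))) ⟩
    c ℚ.* (ι W ℚ.* recip W ℚ.* ι n) ℚ.+ y      ≡⟨ ℚS.solve 5 (λ c w s n y → c :* (w :* s :* n) :+ y := c :* s :* (w :* n) :+ y) refl c (ι W) (recip W) (ι n) y ⟩
    ε ℚ.* (ι W ℚ.* ι n) ℚ.+ y                  ≡⟨ cong (λ z → ε ℚ.* z ℚ.+ y) (trans (sym (ι-* W n)) (trans (cong ι e) (ι-+ u v))) ⟩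
    ε ℚ.* (ι u ℚ.+ ι v) ℚ.+ y                  ≡⟨ ℚS.solve 4 (λ e u v y → e :* (u :+ v) :+ y := e :* u :+ (e :* v :+ y)) refl ε (ι u) (ι v) y ⟩
    ε ℚ.* ι u ℚ.+ (ε ℚ.* ι v ℚ.+ y)            ∎

-- The coordinate sum of the ray, whose two partitions each have total `w t * mid t`; dividing by it
-- brings the ray into the polytope.
size : Ray → ℕ
size t = w t * mid t + w t * mid t

size>0 : ∀ {r} t → Ok r t → 0 < size t
size>0 t ok = ≤-trans (*-mono-≤ (w>0 t ok) (mid>0 t ok)) (m≤m+n (w t * mid t) (w t * mid t))

coordSum-ray : ∀ {r} t → Ok r t → coordSum (rayPoint r t) ≡ ι (size t)
coordSum-ray {r} t ok = trans (coordSum-point r (upper t) (lower t))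
  (trans (cong₂ (λ a b → ι a ℚ.+ ι b) (psum-upper-total t ok) (psum-lower-total t ok)) (sym (ι-+ (w t * mid t) (w t * mid t))))

rayVertex : ∀ r → Ray → Pt r
rayVertex r t = recip (size t) ⊙ rayPoint r t

ray-cone : ∀ {r} t → Ok r t → Cone (rayPoint r t)
ray-cone {r} t ok = cons 1ℚ (upper t) (lower t) 𝟎 (ℚ.<⇒≤ (ℚ.positive⁻¹ 1ℚ)) (ray-pair t ok)
  (nil ((λ _ → refl) , (λ _ → refl))) ((λ i → one (ι (upper t (toℕ i)))) , (λ i → one (ι (lower t (toℕ i)))))
  where
  open ℚS
  one : ∀ a → a ≡ 1ℚ ℚ.* a ℚ.+ 0ℚ
  one = ℚS.solve 1 (λ a → a := con 1ℚ :* a :+ con 0ℚ) refl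

rayVertex∈ : ∀ {r} t → Ok r t → KostkaPolytope r (rayVertex r t)
rayVertex∈ {r} t ok = cone⇒hull (cone-scale (ℚ.<⇒≤ (recip-pos (size>0 t ok))) (ray-cone t ok)) ,
  trans (scale coordSum-linear (recip (size t)) (rayPoint r t))
    (trans (cong (recip (size t) ℚ.*_) (coordSum-ray t ok))
      (trans (ℚ.*-comm (recip (size t)) (ι (size t))) (recip-inverse (size>0 t ok))))

-- Vertices of faces

positive⇒suc : ∀ {m} → 0 < m → ∃[ n ] suc n ≡ m
positive⇒suc {suc n} _ = n , refl

-- `by-mid` is witnessed by the drop of the first partition at the middle, `by-end` by the drop of
-- the second at b. A drop at position n + 1 is `kink n`, which is why these positions must be
-- positive.
triangular⇒independent : ∀ {r ts} → Triangular ts → All (Ok r) ts → Independent (map (rayVertex r) ts)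
triangular⇒independent [] [] = []
triangular⇒independent {r} {t ∷ ts} (by-mid mids tri) (ok ∷ oks)
  with n , eq ← positive⇒suc (mid>0 t ok) = sep (kink n ∘ proj₁) (kink₁-linear n)
  (subst (0ℚ ℚ.<_) (sym (scale (kink₁-linear n) (recip (size t)) (rayPoint r t)))
    (*-pos (recip-pos (size>0 t ok)) (RayKinks.kink-upper>0 r n t ok eq)))
  (All.map⁺ (All.zipWith (λ { {s} (ok′ , ≢) → trans (scale (kink₁-linear n) (recip (size s)) (rayPoint r s))
    (trans (cong (recip (size s) ℚ.*_) (RayKinks.kink-upper≡0 r n s ok′ (λ e → ≢ (trans (sym e) eq)))) (ℚ.*-zeroʳ (recip (size s)))) }) (oks , mids)))
  (triangular⇒independent tri oks)
triangular⇒independent {r} {t ∷ ts} (by-end (suc n) _ b∈ ends tri) (ok ∷ oks) = sep (kink n ∘ proj₂) (kink₂-linear n)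
  (subst (0ℚ ℚ.<_) (sym (scale (kink₂-linear n) (recip (size t)) (rayPoint r t)))
    (*-pos (recip-pos (size>0 t ok)) (RayKinks.kink-lower>0 r n t ok b∈)))
  (All.map⁺ (All.zipWith (λ { {s} (ok′ , ≢) → trans (scale (kink₂-linear n) (recip (size s)) (rayPoint r s))
    (trans (cong (recip (size s) ℚ.*_) (RayKinks.kink-lower≡0 r n s ok′ ≢)) (ℚ.*-zeroʳ (recip (size s)))) }) (oks , ends)))
  (triangular⇒independent tri oks)

module Face (r : ℕ) (a : Pt r) (b : ℚ) (valid : ValidIneq (KostkaPolytope r) a b) where

  F : Pt r → Set
  F = FaceOf (KostkaPolytope r) a b

  -- The homogenised inequality: linear on the whole space, and equal to b - a·x where the
  -- coordinates sum to 1. Linearity lets it be evaluated on unnormalised rays.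
  slack : Pt r → ℚ
  slack x = b ℚ.* coordSum x ℚ.- dot a x

  slack-linear : Linear slack
  slack-linear = combine-linear b coordSum-linear (dot-linear a)

  slack-on-polytope : ∀ x → coordSum x ≡ 1ℚ → slack x ≡ b ℚ.- dot a x
  slack-on-polytope x e = cong (ℚ._- dot a x) (trans (cong (b ℚ.*_) e) (ℚ.*-identityʳ b))

  slack-nonNeg : ∀ x → KostkaPolytope r x → 0ℚ ℚ.≤ slack x
  slack-nonNeg x x∈@(_ , e) = subst (0ℚ ℚ.≤_) (sym (slack-on-polytope x e)) (p≤q⇒0≤q-p (valid x x∈))

  face⇒slack≡0 : ∀ x → F x → slack x ≡ 0ℚ
  face⇒slack≡0 x ((_ , e) , d) = trans (slack-on-polytope x e) (trans (cong (λ x → b ℚ.- x) d) (ℚ.+-inverseʳ b))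

  slack≡0⇒face : ∀ x → KostkaPolytope r x → slack x ≡ 0ℚ → F x
  slack≡0⇒face x x∈@(_ , e) s = x∈ , (begin
    dot a x                       ≡⟨ ℚS.solve 2 (λ b d → d := b :- (b :- d)) refl b (dot a x) ⟩
    b ℚ.- (b ℚ.- dot a x)         ≡⟨ cong (λ x → b ℚ.- x) (trans (sym (slack-on-polytope x e)) s) ⟩
    b ℚ.- 0ℚ                      ≡⟨ ℚ.+-identityʳ b ⟩
    b                             ∎)
    where
    open ≡-Reasoning
    open ℚS

  slack-rayVertex : ∀ t → slack (rayVertex r t) ≡ recip (size t) ℚ.* slack (rayPoint r t)
  slack-rayVertex t = scale slack-linear (recip (size t)) (rayPoint r t)

  -- A vertex v of the face splits off half of some multiple ε of a ray, so that v is a proper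
  -- convex combination of the normalised ray and of a second point y′ of the polytope.
  vertex⇒ray : ∀ v → IsVertex F v → ∃[ t ] (Ok r t × slack (rayPoint r t) ≡ 0ℚ × v ≈P rayVertex r t)
  vertex⇒ray v (v∈F@((v∈hull , v-sum) , _) , extreme) with cone-split (hull⇒cone {x = v} v∈hull)
  ... | inj₁ v≈𝟎 = contradiction (trans (sym v-sum) (trans (F-cong coordSum-linear v 𝟎 v≈𝟎) (F-𝟎 (coordSum-linear {r})))) λ ()
  ... | inj₂ (t , ε , y , ok , ε>0 , C , v≈) = t , ok , slack-ray≡0 , v≈g
    where
    open ≡-Reasoning
    open ℚS
    z g u y′ : Pt r
    S s h τ : ℚ
    z = rayPoint r t
    g = rayVertex r t
    S = ι (size t)
    s = recip (size t)
    h = ½ ℚ.* ε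
    τ = h ℚ.* S
    u = h ⊙ z ⊕ y
    h>0 : 0ℚ ℚ.< h
    h>0 = *-pos (ℚ.positive⁻¹ ½) ε>0
    τ>0 : 0ℚ ℚ.< τ
    τ>0 = *-pos h>0 (ι-pos (size>0 t ok))
    coordSum-split : ∀ c → coordSum (c ⊙ z ⊕ y) ≡ c ℚ.* S ℚ.+ coordSum y
    coordSum-split c = trans (add coordSum-linear (c ⊙ z) y)
      (cong (ℚ._+ coordSum y) (trans (scale coordSum-linear c z) (cong (c ℚ.*_) (coordSum-ray t ok))))
    u-sum : coordSum u ≡ 1ℚ ℚ.- τ
    u-sum = begin
      coordSum u                              ≡⟨ coordSum-split h ⟩
      h ℚ.* S ℚ.+ coordSum y                  ≡⟨ ℚS.solve 3 (λ e S y → con ½ :* e :* S :+ y := e :* S :+ y :- con ½ :* e :* S) refl ε S (coordSum y) ⟩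
      ε ℚ.* S ℚ.+ coordSum y ℚ.- τ            ≡⟨ cong (ℚ._- τ) (sym (coordSum-split ε)) ⟩
      coordSum (ε ⊙ z ⊕ y) ℚ.- τ              ≡⟨ cong (ℚ._- τ) (sym (F-cong coordSum-linear v (ε ⊙ z ⊕ y) v≈)) ⟩
      coordSum v ℚ.- τ                        ≡⟨ cong (ℚ._- τ) v-sum ⟩
      1ℚ ℚ.- τ                                ∎
    -- The half of the ray that stays in u contributes τ to its coordinate sum, which is therefore
    -- positive even when y is zero.
    1-τ>0 : 0ℚ ℚ.< 1ℚ ℚ.- τ
    1-τ>0 = subst (0ℚ ℚ.<_) (trans (sym (coordSum-split h)) u-sum)
      (ℚ.+-mono-<-≤ τ>0 (coordSum-nonNeg C))
    τ<1 : τ ℚ.< 1ℚ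
    τ<1 = subst₂ ℚ._<_ (ℚ.+-identityˡ τ) (ℚS.solve 1 (λ t → con 1ℚ :- t :+ t := con 1ℚ) refl τ)
      (ℚ.+-monoˡ-< τ 1-τ>0)
    inv = pos⇒inverse 1-τ>0
    ρ : ℚ
    ρ = proj₁ inv
    y′ = ρ ⊙ u
    y′∈ : KostkaPolytope r y′
    y′∈ = cone⇒hull (cone-scale (ℚ.<⇒≤ (proj₁ (proj₂ inv)))
            (cons h (upper t) (lower t) y (ℚ.<⇒≤ h>0) (ray-pair t ok) C ((λ _ → refl) , (λ _ → refl)))) ,
          trans (scale coordSum-linear ρ u) (trans (cong (ρ ℚ.*_) u-sum) (trans (ℚ.*-comm ρ (1ℚ ℚ.- τ)) (proj₂ (proj₂ inv))))
    g∈ : KostkaPolytope r g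
    g∈ = rayVertex∈ t ok
    recombine : ∀ {v z y} → v ≡ ε ℚ.* z ℚ.+ y → v ≡ τ ℚ.* (s ℚ.* z) ℚ.+ ((1ℚ ℚ.- τ) ℚ.* (ρ ℚ.* (h ℚ.* z ℚ.+ y)) ℚ.+ 0ℚ)
    recombine {v} {z} {y} e = sym (begin
      h ℚ.* S ℚ.* (s ℚ.* z) ℚ.+ ((1ℚ ℚ.- τ) ℚ.* (ρ ℚ.* (h ℚ.* z ℚ.+ y)) ℚ.+ 0ℚ)
        ≡⟨ ℚS.solve 7 (λ h S s z t ρ x → h :* S :* (s :* z) :+ (t :* (ρ :* x) :+ con 0ℚ) := h :* (S :* s) :* z :+ t :* ρ :* x)
             refl h S s z (1ℚ ℚ.- τ) ρ (h ℚ.* z ℚ.+ y) ⟩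
      h ℚ.* (S ℚ.* s) ℚ.* z ℚ.+ (1ℚ ℚ.- τ) ℚ.* ρ ℚ.* (h ℚ.* z ℚ.+ y)
        ≡⟨ cong₂ (λ p q → h ℚ.* p ℚ.* z ℚ.+ q ℚ.* (h ℚ.* z ℚ.+ y)) (recip-inverse (size>0 t ok)) (proj₂ (proj₂ inv)) ⟩
      h ℚ.* 1ℚ ℚ.* z ℚ.+ 1ℚ ℚ.* (h ℚ.* z ℚ.+ y)
        ≡⟨ ℚS.solve 3 (λ e z y → con ½ :* e :* con 1ℚ :* z :+ con 1ℚ :* (con ½ :* e :* z :+ y) := e :* z :+ y) refl ε z y ⟩
      ε ℚ.* z ℚ.+ y
        ≡⟨ sym e ⟩
      v ∎)
    v≈mix : v ≈P ((τ ⊙ g) ⊕ ((1ℚ ℚ.- τ) ⊙ y′ ⊕ 𝟎))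
    v≈mix = (λ i → recombine (proj₁ v≈ i)) , (λ i → recombine (proj₂ v≈ i))
    -- Extremality of v concerns only points of the face, so g and y′ must be shown to lie in it:
    -- their nonnegative slacks have the positive combination `slack v`, which is 0.
    slacks≡0 : slack g ≡ 0ℚ × slack y′ ≡ 0ℚ
    slacks≡0 = weighted≡0⇒≡0 τ>0 1-τ>0 (slack-nonNeg g g∈) (slack-nonNeg y′ y′∈) (begin
      τ ℚ.* slack g ℚ.+ (1ℚ ℚ.- τ) ℚ.* slack y′
        ≡⟨ cong₂ ℚ._+_ (sym (scale slack-linear τ g)) (sym (trans (ℚ.+-identityʳ _) (scale slack-linear (1ℚ ℚ.- τ) y′))) ⟩
      slack (τ ⊙ g) ℚ.+ (slack ((1ℚ ℚ.- τ) ⊙ y′) ℚ.+ 0ℚ)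
        ≡⟨ cong (λ x → slack (τ ⊙ g) ℚ.+ (slack ((1ℚ ℚ.- τ) ⊙ y′) ℚ.+ x)) (sym (F-𝟎 slack-linear)) ⟩
      slack (τ ⊙ g) ℚ.+ (slack ((1ℚ ℚ.- τ) ⊙ y′) ℚ.+ slack 𝟎)
        ≡⟨ cong (slack (τ ⊙ g) ℚ.+_) (sym (add slack-linear ((1ℚ ℚ.- τ) ⊙ y′) 𝟎)) ⟩
      slack (τ ⊙ g) ℚ.+ slack ((1ℚ ℚ.- τ) ⊙ y′ ⊕ 𝟎)
        ≡⟨ sym (add slack-linear (τ ⊙ g) ((1ℚ ℚ.- τ) ⊙ y′ ⊕ 𝟎)) ⟩
      slack ((τ ⊙ g) ⊕ ((1ℚ ℚ.- τ) ⊙ y′ ⊕ 𝟎))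
        ≡⟨ sym (F-cong slack-linear v ((τ ⊙ g) ⊕ ((1ℚ ℚ.- τ) ⊙ y′ ⊕ 𝟎)) v≈mix) ⟩
      slack v ≡⟨ face⇒slack≡0 v v∈F ⟩
      0ℚ ∎)
    slack-ray≡0 : slack z ≡ 0ℚ
    slack-ray≡0 = pos-cancel-≡ (recip-pos (size>0 t ok)) (trans (sym (slack-rayVertex t)) (proj₁ slacks≡0))
    g≈y′ : g ≈P y′
    g≈y′ = extreme g y′ τ (slack≡0⇒face g g∈ (proj₁ slacks≡0)) (slack≡0⇒face y′ y′∈ (proj₂ slacks≡0)) τ>0 τ<1 v≈mix
    collapse : ∀ {v g y′} → v ≡ τ ℚ.* g ℚ.+ ((1ℚ ℚ.- τ) ℚ.* y′ ℚ.+ 0ℚ) → g ≡ y′ → v ≡ g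
    collapse {v} {g} e refl = trans e (ℚS.solve 2 (λ t g → t :* g :+ ((con 1ℚ :- t) :* g :+ con 0ℚ) := g) refl τ g)
    v≈g : v ≈P g
    v≈g = (λ i → collapse (proj₁ v≈mix i) (proj₁ g≈y′ i)) , (λ i → collapse (proj₂ v≈mix i) (proj₂ g≈y′ i))

  H Q : ℕ → ℚ
  H = slack ∘ unit₁
  Q = slack ∘ unit₂

  slack-ray : ∀ t → slack (rayPoint r t) ≡ pairing H Q t
  slack-ray = linear-ray slack-linear

  pairing-nonNeg : ∀ t → Ok r t → 0ℚ ℚ.≤ pairing H Q t
  pairing-nonNeg t ok = subst (0ℚ ℚ.≤_) (slack-ray t) (pos-cancel-≤ (recip-pos (size>0 t ok))
    (subst (0ℚ ℚ.≤_) (slack-rayVertex t) (slack-nonNeg (rayVertex r t) (rayVertex∈ t ok))))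

  open TightRays r H Q pairing-nonNeg

  tight⇒face : ∀ {t} → Tight t → F (rayVertex r t)
  tight⇒face {t} (ok , tight) = slack≡0⇒face (rayVertex r t) (rayVertex∈ t ok)
    (trans (slack-rayVertex t) (trans (cong (recip (size t) ℚ.*_) (trans (slack-ray t) tight)) (ℚ.*-zeroʳ (recip (size t)))))

  rank≤ : ∀ {d} → HasDimension F d → length inners + length middles ≤ d + 1
  rank≤ {d} (_ , max) = let ts , len , tri , tights = independent-rays in
    subst₂ _≤_ (trans (length-map (rayVertex r) ts) len) (+-comm 1 d)
      (independent⇒length≤ {F = F} max (triangular⇒independent tri (All.map proj₁ tights)) (All.map⁺ (All.map tight⇒face tights)))

  vertices≤ : ∀ {d} → HasDimension F d → ∀ k (v : Fin k → Pt r) → Distinct v → (∀ j → IsVertex F (v j)) →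
              k ≤ ((d + 3) / 3) * ((d + 4) / 3) * ((d + 5) / 3)
  vertices≤ {d} dim k v distinct vertices = ≤-trans
    (injection⇒≤length ray injective (λ j → tight∈tightRays (ray j) (proj₁ (proj₂ (found j)) , trans (sym (slack-ray (ray j))) (proj₁ (proj₂ (proj₂ (found j)))))))
    (length-tightRays d (rank≤ dim))
    where
    found : ∀ j → ∃[ t ] (Ok r t × slack (rayPoint r t) ≡ 0ℚ × v j ≈P rayVertex r t)
    found j = vertex⇒ray (v j) (vertices j)
    ray : Fin k → Ray
    ray j = proj₁ (found j)
    v≈ : ∀ j → v j ≈P rayVertex r (ray j)
    v≈ j = proj₂ (proj₂ (proj₂ (found j)))
    injective : ∀ {i j} → ray i ≡ ray j → i ≡ j
    injective {i} {j} eq = distinct i j (≈-trans (v i) (rayVertex r (ray j)) (v j)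
      (subst (λ t → v i ≈P rayVertex r t) eq (v≈ i)) (≈-sym (v j) (rayVertex r (ray j)) (v≈ j)))

theorem3p6 : ∀ (r d : ℕ) → 1 ≤ r → d ≤ 2 * r ∸ 2 →
    ∀ (a : Pt r) (b : ℚ) → ValidIneq (KostkaPolytope r) a b →
    HasDimension (FaceOf (KostkaPolytope r) a b) d →
    ∀ (k : ℕ) (v : Fin k → Pt r) → Distinct v →
    (∀ j → IsVertex (FaceOf (KostkaPolytope r) a b) (v j)) →
    k ≤ ((d + 3) / 3) * ((d + 4) / 3) * ((d + 5) / 3)
theorem3p6 r d _ _ a b valid dim = Face.vertices≤ r a b valid dim
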